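{- For the cubillage $Q$ on $Z(4,3)$ that contains the vertex $13=\{1,3\}$, the set $V_Q$ is neither s-pure nor w-pure.
   Context: Notation: $[n]=\{1,\ldots,n\}$; $A-B=\{a\in A: a\notin B\}$. Separation: for $A,B\subseteq[n]$ write $A<B$ if $\max(A)<\min(B)$ (with $\max(\emptyset)=\min(\emptyset)=0$). $A,B$ are strongly separated if $A=B$ or $(A-B)<(B-A)$ or $(B-A)<(A-B)$. $A$ surrounds $B$ if there are no $i<j<k$ in $[n]$ with $i,k\in B-A$ and $j\in A-B$; $A,B$ are weakly separated if either $|A|\le|B|$ and $A$ surrounds $B$, or $|B|\le|A|$ and $B$ surrounds $A$ (or both). A collection is an s-collection (w-collection) if any two of its members are strongly (weakly) separated. A domain $\mathcal D\subseteq2^{[n]}$ is s-pure (w-pure) if all inclusion-wise maximal s-collections (resp. w-collections) contained in $\mathcal D$ have the same cardinality. Zonotope and cubillages (here $n=4$): $\theta_i=(x_i,y_i,1)\in\mathbb R^3$, $i=1,\ldots,n$, are fixed vectors with $x_1<\cdots<x_n$ and the points $(x_i,y_i)$ in strictly convex position forming a lower convex chain (for $i<j<k$, $(x_j,y_j)$ lies strictly below the segment joining $(x_i,y_i)$ and $(x_k,y_k)$; e.g. $y_i=x_i^2$); the $\theta_i$ are assumed $\mathbb Z$-independent. $Z=Z(n,3)$ is the Minkowski sum of the segments $[0,\theta_i]$. A subset $X\subseteq[n]$ is identified with the point $\sum_{i\in X}\theta_i$. For $i<j<k$, $X\subseteq[n]-\{i,j,k\}$, the cube $\zeta(X|ijk)$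 is $X+\{\lambda\theta_i+\lambda'\theta_j+\lambda''\theta_k:0\le\lambda,\lambda',\lambda''\le1\}$. A cubillage $Q$ on $Z$ is a subdivision of $Z$ into cubes of this form such that any two intersect only by a common face and any face of the boundary of $Z$ is a face of some cube. $V_Q\subseteq2^{[n]}$ is its set of vertices, regarded as subsets of $[n]$. There are exactly two cubillages on $Z(4,3)$: one having $\{1,3\}$ as a vertex and the other having $\{2,4\}$. -}

module Defs where

open import Level using (Level; _⊔_; suc; 0ℓ)
open import Algebra.Bundles using (CommutativeRing)
import Algebra.Definitions.RawMonoid as RawMonoidDefinitions
open import Data.Bool.Base using (if_then_else_)
open import Data.Fin.Base as Fin using (Fin; toℕ)
open import Data.Fin.Subset using (Subset; inside; outside; _∈_; _∉_; _─_; ∣_∣)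
open import Data.Fin.Subset.Properties using (_∈?_)
open import Data.Integer.Base using (ℤ; +_; -[1+_]; 0ℤ)
open import Data.List.Base using (List; []; _∷_; length; map; filter; allFin)
import Data.List.Extrema.Nat as Extrema
import Data.List.Membership.Propositional as List
import Data.List.Relation.Binary.Subset.Propositional as List
open import Data.List.Relation.Unary.Unique.Propositional using (Unique)
import Data.Nat.Base as ℕ
open import Data.Product.Base using (Σ-syntax; ∃-syntax; _×_)
open import Data.Sum.Base using (_⊎_)
import Data.Vec.Base as Vec
open import Data.Vec.Functional as Vector using (Vector)
open import Relation.Binary.Core using (Rel)
import Relation.Binary.Construct.StrictToNonStrict as StrictToNonStrict
open import Relation.Binary.PropositionalEquality.Core using (_≡_)
open import Relation.Binary.Structures using (IsStrictTotalOrder)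
open import Relation.Nullary.Negation.Core using (¬_)
open import Relation.Unary using (Pred; _≐_; _∩_) renaming (_⊆_ to _⊆ₚ_)

------------------------------------------------------------------------
-- Separation of subsets of [n]

private
  variable
    n : ℕ.ℕ

-- An index i : Fin n stands for the element suc (toℕ i) of [n] = {1,…,n}.
elements : Subset n → List ℕ.ℕ
elements A = map (λ i → ℕ.suc (toℕ i)) (filter (_∈? A) (allFin _))

minimum maximum : List ℕ.ℕ → ℕ.ℕ
minimum []       = 0
minimum (x ∷ xs) = Extrema.min x xs
maximum xs       = Extrema.max 0 xs

infix 4 _≪_ _Surrounds_

_≪_ : Rel (Subset n) 0ℓ
A ≪ B = maximum (elements A) ℕ.< minimum (elements B)

StronglySeparated : Rel (Subset n) 0ℓ
StronglySeparated A B = A ≡ B ⊎ ((A ─ B) ≪ (B ─ A) ⊎ (B ─ A) ≪ (A ─ B))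

_Surrounds_ : Rel (Subset n) 0ℓ
A Surrounds B = ¬ (∃[ i ] ∃[ j ] ∃[ k ]
  (i Fin.< j × j Fin.< k × i ∈ (B ─ A) × k ∈ (B ─ A) × j ∈ (A ─ B)))

WeaklySeparated : Rel (Subset n) 0ℓ
WeaklySeparated A B =
  (∣ A ∣ ℕ.≤ ∣ B ∣ × A Surrounds B) ⊎ (∣ B ∣ ℕ.≤ ∣ A ∣ × B Surrounds A)

-- Collections are duplicate-free lists, so that length is cardinality.
module Purity {n : ℕ.ℕ} {ℓ : Level} (Separated : Rel (Subset n) 0ℓ)
              (𝒟 : Pred (Subset n) ℓ) where

  IsCollection : List (Subset n) → Set ℓ
  IsCollection C =
      Unique C
    × (∀ {A} → A List.∈ C → 𝒟 A)
    × (∀ {A B} → A List.∈ C → B List.∈ C → Separated A B)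

  IsMaximalCollection : List (Subset n) → Set ℓ
  IsMaximalCollection C =
    IsCollection C × (∀ C′ → IsCollection C′ → C List.⊆ C′ → C′ List.⊆ C)

  Pure : Set ℓ
  Pure = ∀ C C′ → IsMaximalCollection C → IsMaximalCollection C′ →
         length C ≡ length C′

SPure WPure : ∀ {ℓ} → Pred (Subset n) ℓ → Set ℓ
SPure = Purity.Pure StronglySeparated
WPure = Purity.Pure WeaklySeparated

------------------------------------------------------------------------
-- Ordered fields

-- Used in place of ℝ, which the standard library does not provide.
record OrderedField c ℓ₁ ℓ₂ : Set (suc (c ⊔ ℓ₁ ⊔ ℓ₂)) where
  field
    commutativeRing : CommutativeRing c ℓ₁

  open CommutativeRing commutativeRing public

  infix 4 _<_

  field
    _<_                : Rel Carrier ℓ₂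
    isStrictTotalOrder : IsStrictTotalOrder _≈_ _<_
    +-monoʳ-<          : ∀ x {y z} → y < z → x + y < x + z
    *-positive         : ∀ {x y} → 0# < x → 0# < y → 0# < x * y
    0≉1                : ¬ 0# ≈ 1#
    inverse            : ∀ x → ¬ x ≈ 0# → ∃[ y ] x * y ≈ 1#

  open StrictToNonStrict _≈_ _<_ public using (_≤_)
  open RawMonoidDefinitions +-rawMonoid public
    using (sum) renaming (_×_ to _×ℕ_)

  infixr 8 _×ℤ_

  _×ℤ_ : ℤ → Carrier → Carrier
  (+ m)    ×ℤ x = m ×ℕ x
  -[1+ m ] ×ℤ x = - (ℕ.suc m ×ℕ x)

  InUnitInterval : Pred Carrier (ℓ₁ ⊔ ℓ₂)
  InUnitInterval t = 0# ≤ t × t ≤ 1#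

------------------------------------------------------------------------
-- Three-dimensional space and faces of convex sets

module Space {c ℓ₁ ℓ₂} (F : OrderedField c ℓ₁ ℓ₂) where
  open OrderedField F

  Point : Set c
  Point = Vector Carrier 3

  infix 4 _≋_

  _≋_ : Rel Point ℓ₁
  p ≋ q = ∀ d → p d ≈ q d

  _∙_ : Point → Point → Carrier
  w ∙ p = sum (λ d → w d * p d)

  Region : Set (suc (c ⊔ ℓ₁ ⊔ ℓ₂))
  Region = Pred Point (c ⊔ ℓ₁ ⊔ ℓ₂)

  -- Faces are cut out by valid linear inequalities.  Taking w = 0 shows
  -- that ∅ and the whole of P count as faces of P.
  IsFace : ∀ {ℓ} → Region → Pred Point ℓ → Set (c ⊔ ℓ₁ ⊔ ℓ₂ ⊔ ℓ)
  IsFace P G = ∃[ w ] ∃[ b ]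
    ((∀ {p} → P p → w ∙ p ≤ b) × G ≐ (λ p → P p × w ∙ p ≈ b))

------------------------------------------------------------------------
-- The vectors θ₁,…,θₙ

record Configuration {c ℓ₁ ℓ₂} (F : OrderedField c ℓ₁ ℓ₂) (n : ℕ.ℕ)
       : Set (c ⊔ ℓ₁ ⊔ ℓ₂) where
  open OrderedField F
  open Space F

  field
    x y : Fin n → Carrier

  θ : Fin n → Point
  θ i = x i Vector.∷ y i Vector.∷ 1# Vector.∷ Vector.[]

  field
    x-increasing : ∀ {i j} → i Fin.< j → x i < x j

    -- (x j , y j) lies strictly below the point of the segment from
    -- (x i , y i) to (x k , y k) with the same first coordinate.
    lower-chain : ∀ {i j k} → i Fin.< j → j Fin.< k →
      ∀ t → InUnitInterval t →
      x j ≈ (1# - t) * x i + t * x k →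
      y j < (1# - t) * y i + t * y k

    ℤ-independent : ∀ (m : Fin n → ℤ) →
      (∀ d → sum (λ i → m i ×ℤ θ i d) ≈ 0#) → ∀ i → m i ≡ 0ℤ

------------------------------------------------------------------------
-- Zonotopes and cubillages

-- The combinatorial type (X | ijk) of a cube.
record Cube (n : ℕ.ℕ) : Set where
  field
    X     : Subset n
    i j k : Fin n
    i<j   : i Fin.< j
    j<k   : j Fin.< k
    i∉X   : i ∉ X
    j∉X   : j ∉ X
    k∉X   : k ∉ X

module Cubillages {c ℓ₁ ℓ₂} (F : OrderedField c ℓ₁ ℓ₂) {n : ℕ.ℕ}
                  (Θ : Configuration F n) where
  open OrderedField F
  open Space F
  open Configuration Θ

  zonotope : Region
  zonotope p = Σ[ t ∈ Vector Carrier n ]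
    ((∀ i → InUnitInterval (t i)) × p ≋ (λ d → sum (λ i → t i * θ i d)))

  ⟦_⟧ : Subset n → Point
  ⟦ X ⟧ d = sum (λ i → if Vec.lookup X i then θ i d else 0#)

  ζ : Cube n → Region
  ζ C p = ∃[ r ] ∃[ s ] ∃[ t ]
    ( InUnitInterval r × InUnitInterval s × InUnitInterval t
    × p ≋ (λ d → ⟦ X ⟧ d + (r * θ i d + (s * θ j d + t * θ k d))))
    where open Cube C

  record IsCubillage (Q : List (Cube n)) : Set (suc (c ⊔ ℓ₁ ⊔ ℓ₂)) where
    field
      covers : zonotope ≐ (λ p → ∃[ C ] (C List.∈ Q × ζ C p))

      common-faces : ∀ {C D} → C List.∈ Q → D List.∈ Q →
        IsFace (ζ C) (ζ C ∩ ζ D) × IsFace (ζ D) (ζ C ∩ ζ D)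

      boundary-faces : ∀ (G : Region) →
        IsFace zonotope G → ¬ (zonotope ⊆ₚ G) →
        ∃[ C ] (C List.∈ Q × IsFace (ζ C) G)

  -- X is a vertex of Q when the point ⟦ X ⟧ is a face of a cube of Q.
  V : List (Cube n) → Pred (Subset n) (c ⊔ ℓ₁ ⊔ ℓ₂)
  V Q X = ∃[ C ] (C List.∈ Q × IsFace (ζ C) (_≋ ⟦ X ⟧))

-- {1,3} ⊆ [4]
[13] : Subset 4
[13] = inside Vec.∷ outside Vec.∷ inside Vec.∷ outside Vec.∷ Vec.[]

{-# OPTIONS --safe #-}
module Submission where

-- A point Σ tᵢθᵢ is given the coordinates sᵢ = tᵢ for i = 1, 3 and sᵢ = 1 − tᵢ for i = 2, 4.
-- The only affine dependence of the θᵢ alternates in sign, so in these coordinates the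
-- vectors s representing a given point form a line with positive direction.  The zonotope
-- is the image of the unit 4-cube, cubes are images of its facets sₘ = 1 (upper) and sₘ = 0
-- (lower), and the sets 13 and 24 are the images of (1,1,1,1) and (0,0,0,0).
--
-- An upper and a lower cube with different m share a point interior to one of them, but
-- neither contains the other, so they do not meet in a common face.  An upper and a lower
-- cube with the same m leave part of the zonotope to a third cube, which then clashes with
-- one of the two.  So a cubillage uses only upper or only lower cubes.  By ℤ-independence
-- 13 is a vertex of upper cubes only and 24 of lower cubes only, so they are not both
-- vertices of Q.  The other 14 sets are vertices of the zonotope, hence V_Q consists of all
-- sets but 24.  It contains maximal collections of 10 and of 11 sets, the same two for
-- strong and weak separation.

open import Defs
open import Algebra.Bundles using (CommutativeRing)
import Algebra.Properties.CommutativeMonoid.Sum as Sums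
import Algebra.Properties.Ring as RingProperties
import Algebra.Properties.Semiring.Mult.TCOptimised as Multiples
import Algebra.Solver.Ring as RingSolver
import Algebra.Solver.Ring.AlmostCommutativeRing as Almost
open import Data.Bool.Base using (Bool; true; false; not; if_then_else_)
import Data.Bool.Properties as Bool
open import Data.Empty using (⊥; ⊥-elim)
open import Data.Fin.Base as Fin using (Fin; punchIn)
open import Data.Fin.Patterns using (0F; 1F; 2F; 3F)
open import Data.Fin.Properties using (_≟_; _<?_; all?; any?; punchIn-punchOut)
open import Data.Fin.Subset
  using (Subset; inside; outside; _∉_; ⁅_⁆; _∪_; _─_; ∣_∣)
open import Data.Fin.Subset.Properties using (_∈?_)
open import Data.Integer.Base as ℤ using (ℤ; +_; -[1+_]; _◃_; _⊖_)
import Data.Integer.Properties as ℤ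
open import Data.List.Base as List using (List; []; _∷_; _++_; length; filter)
import Data.List.Membership.DecPropositional as DecMembership
import Data.List.Membership.Propositional as List
open import Data.List.Membership.Propositional using (find)
open import Data.List.Membership.Propositional.Properties using (∈-++⁺ˡ; ∈-++⁺ʳ; ∈-map⁺)
open import Data.List.Relation.Unary.All as All using (All)
open import Data.List.Relation.Unary.Any as Any using (Any; here)
import Data.List.Relation.Unary.Unique.DecPropositional as DecUnique
open import Data.List.Relation.Unary.Unique.Propositional using (Unique)
open import Data.Maybe.Base as Maybe using (Maybe)
open import Data.Nat.Base as ℕ using (s≤s; z≤n)
import Data.Nat.Properties as ℕ
open import Data.Product.Base using (_×_; _,_; proj₁; proj₂; ∃-syntax)
import Data.Sign.Base as Sign
open import Data.Sum.Base using (_⊎_; inj₁; inj₂)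
open import Data.Vec.Base as Vec using (lookup)
open import Data.Vec.Functional as Vector using (Vector; updateAt)
open import Data.Vec.Functional.Properties
  using (updateAt-updates; updateAt-minimal; insertAt-lookup; insertAt-punchIn)
open import Data.Vec.Properties using (lookup⇒[]=; ≡-dec)
open import Function.Base using (_∘_; case_of_)
open import Level using (Level; _⊔_; Lift; lift; lower)
open import Relation.Binary.Core using (Rel)
open import Relation.Binary.Definitions
  using (DecidableEquality; tri<; tri≈; tri>) renaming (Decidable to Decidable₂)
open import Relation.Binary.PropositionalEquality.Core as ≡ using (_≡_; _≢_)
import Relation.Binary.Reasoning.Setoid as SetoidReasoning
open import Relation.Binary.Structures using (IsStrictTotalOrder)
open import Relation.Nullary.Decidable
  using (Dec; yes; no; ¬?; _×-dec_; _⊎-dec_; _→-dec_; map′; toWitness; dec⇒maybe)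
open import Relation.Nullary.Negation.Core using (¬_; contradiction)
open import Relation.Unary using (Pred; Decidable; _≐_; _∩_)

-- Integer coefficients for the ring solver

module IntegerSolver {c ℓ} (R : CommutativeRing c ℓ) where
  open CommutativeRing R
  open RingProperties ring
  open Multiples semiring
    renaming (_×_ to _·_; ×-homo-+ to ·-homo-+; ×1-homo-* to ·1-homo-*; 1+× to 1+·)
  open SetoidReasoning setoid

  -- With this form of multiples `1 · 1#` computes to `1#` and `0 · 1#` to `0#`, so the solver
  -- constants `con (+ 1)` and `con (+ 0)` denote the field constants themselves and solved
  -- equations close with `refl`.
  fromℤ : ℤ → Carrier
  fromℤ (+ n)    = n · 1#
  fromℤ -[1+ n ] = - (ℕ.suc n · 1#)

  fromℤ-neg : ∀ i → fromℤ (ℤ.- i) ≈ - fromℤ i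
  fromℤ-neg (+ ℕ.zero)  = sym -0#≈0#
  fromℤ-neg (+ ℕ.suc n) = refl
  fromℤ-neg -[1+ n ]    = sym (-‿involutive _)

  fromℤ-⊖ : ∀ m n → fromℤ (m ⊖ n) ≈ m · 1# - n · 1#
  fromℤ-⊖ m ℕ.zero = sym (begin
    m · 1# - 0#        ≈⟨ +-congˡ -0#≈0# ⟩
    m · 1# + 0#        ≈⟨ +-identityʳ _ ⟩
    m · 1#             ∎)
  fromℤ-⊖ ℕ.zero (ℕ.suc n) = sym (+-identityˡ _)
  fromℤ-⊖ (ℕ.suc m) (ℕ.suc n) = begin
    fromℤ (ℕ.suc m ⊖ ℕ.suc n)          ≡⟨ ≡.cong fromℤ (ℤ.[1+m]⊖[1+n]≡m⊖n m n) ⟩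
    fromℤ (m ⊖ n)                      ≈⟨ fromℤ-⊖ m n ⟩
    -- Inserting `1# - 1#` turns a difference of multiples into the difference of their successors.
    m · 1# - n · 1#                    ≈⟨ +-congˡ (-x≈1-[1+x] _) ⟩
    m · 1# + (1# - (1# + n · 1#))      ≈⟨ +-assoc _ _ _ ⟨
    m · 1# + 1# - (1# + n · 1#)        ≈⟨ +-congʳ (+-comm _ _) ⟩
    1# + m · 1# - (1# + n · 1#)        ≈⟨ +-cong (1+· m 1#) (-‿cong (1+· n 1#)) ⟨
    ℕ.suc m · 1# - ℕ.suc n · 1#        ∎
    where
    -x≈1-[1+x] : ∀ y → - y ≈ 1# - (1# + y)
    -x≈1-[1+x] y = begin
      - y                ≈⟨ +-identityˡ _ ⟨
      0# - y             ≈⟨ +-congʳ (-‿inverseʳ 1#) ⟨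
      1# - 1# - y        ≈⟨ +-assoc _ _ _ ⟩
      1# + (- 1# - y)    ≈⟨ +-congˡ (-‿+-comm 1# y) ⟩
      1# - (1# + y)      ∎

  fromℤ-+ : ∀ i j → fromℤ (i ℤ.+ j) ≈ fromℤ i + fromℤ j
  fromℤ-+ (+ m)    (+ n)    = ·-homo-+ 1# m n
  fromℤ-+ (+ m)    -[1+ n ] = fromℤ-⊖ m (ℕ.suc n)
  fromℤ-+ -[1+ m ] (+ n)    = trans (fromℤ-⊖ n (ℕ.suc m)) (+-comm _ _)
  fromℤ-+ -[1+ m ] -[1+ n ] = begin
    fromℤ (-[1+ m ] ℤ.+ -[1+ n ])       ≡⟨ ≡.cong fromℤ (ℤ.neg-distrib-+ (+ ℕ.suc m) (+ ℕ.suc n)) ⟨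
    - ((ℕ.suc m ℕ.+ ℕ.suc n) · 1#)      ≈⟨ -‿cong (·-homo-+ 1# (ℕ.suc m) (ℕ.suc n)) ⟩
    - (ℕ.suc m · 1# + ℕ.suc n · 1#)     ≈⟨ -‿+-comm _ _ ⟨
    - (ℕ.suc m · 1#) - ℕ.suc n · 1#     ∎

  -- Integer products are normalised through `◃`, which sends a negative sign with absolute value
  -- zero to `+ 0`; hence the separate case.
  fromℤ-◃ : ∀ n → fromℤ (Sign.- ◃ n) ≈ - (n · 1#)
  fromℤ-◃ ℕ.zero    = sym -0#≈0#
  fromℤ-◃ (ℕ.suc n) = refl

  fromℤ-+◃ : ∀ n → fromℤ (Sign.+ ◃ n) ≈ n · 1#
  fromℤ-+◃ n = reflexive (≡.cong fromℤ (ℤ.+◃n≡+n n))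

  fromℤ-* : ∀ i j → fromℤ (i ℤ.* j) ≈ fromℤ i * fromℤ j
  fromℤ-* (+ m)    (+ n)    = trans (fromℤ-+◃ (m ℕ.* n)) (·1-homo-* m n)
  fromℤ-* (+ m)    -[1+ n ] = begin
    fromℤ (Sign.- ◃ m ℕ.* ℕ.suc n)      ≈⟨ fromℤ-◃ (m ℕ.* ℕ.suc n) ⟩
    - ((m ℕ.* ℕ.suc n) · 1#)            ≈⟨ -‿cong (·1-homo-* m (ℕ.suc n)) ⟩
    - (m · 1# * (ℕ.suc n · 1#))         ≈⟨ -‿distribʳ-* _ _ ⟩
    m · 1# * - (ℕ.suc n · 1#)           ∎
  fromℤ-* -[1+ m ] (+ n)    = begin
    fromℤ (Sign.- ◃ ℕ.suc m ℕ.* n)      ≈⟨ fromℤ-◃ (ℕ.suc m ℕ.* n) ⟩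
    - ((ℕ.suc m ℕ.* n) · 1#)            ≈⟨ -‿cong (·1-homo-* (ℕ.suc m) n) ⟩
    - (ℕ.suc m · 1# * (n · 1#))         ≈⟨ -‿distribˡ-* _ _ ⟩
    - (ℕ.suc m · 1#) * (n · 1#)         ∎
  fromℤ-* -[1+ m ] -[1+ n ] = begin
    (ℕ.suc m ℕ.* ℕ.suc n) · 1#            ≈⟨ ·1-homo-* (ℕ.suc m) (ℕ.suc n) ⟩
    ℕ.suc m · 1# * (ℕ.suc n · 1#)         ≈⟨ -‿involutive _ ⟨
    - - (ℕ.suc m · 1# * (ℕ.suc n · 1#))   ≈⟨ -‿cong (-‿distribʳ-* _ _) ⟩
    - (ℕ.suc m · 1# * - (ℕ.suc n · 1#))   ≈⟨ -‿distribˡ-* _ _ ⟩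
    - (ℕ.suc m · 1#) * - (ℕ.suc n · 1#)   ∎

  almost : Almost.AlmostCommutativeRing c ℓ
  almost = Almost.fromCommutativeRing R

  morphism : ℤ.+-*-rawRing Almost.-Raw-AlmostCommutative⟶ almost
  morphism = record
    { ⟦_⟧    = fromℤ
    ; +-homo = fromℤ-+
    ; *-homo = fromℤ-*
    ; -‿homo = fromℤ-neg
    ; 0-homo = refl
    ; 1-homo = refl
    }

  fromℤ-≟ : ∀ i j → Maybe (fromℤ i ≈ fromℤ j)
  fromℤ-≟ i j = Maybe.map (λ i≡j → reflexive (≡.cong fromℤ i≡j)) (dec⇒maybe (i ℤ.≟ j))

  open RingSolver ℤ.+-*-rawRing almost morphism fromℤ-≟ public
    using (solve; _:=_; _:+_; _:*_; _:-_; :-_; con)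

-- Alternating coordinates and the affine dependence

module Coordinates {c ℓ₁ ℓ₂} (F : OrderedField c ℓ₁ ℓ₂) (Θ : Configuration F 4) where
  open OrderedField F
  open Space F
  open Configuration Θ
  open IntegerSolver commutativeRing
  open SetoidReasoning setoid

  flip : Fin 4 → Carrier → Carrier
  flip 0F a = a
  flip 1F a = 1# - a
  flip 2F a = a
  flip 3F a = 1# - a

  -- The linear part of `flip`: complementing a coordinate negates its variation.
  sign : Fin 4 → Carrier → Carrier
  sign 0F a = a
  sign 1F a = - a
  sign 2F a = a
  sign 3F a = - a

  point : Vector Carrier 4 → Point
  point s d = sum (λ i → flip i (s i) * θ i d)

  -- The determinant of `θ i`, `θ j`, `θ k`, that is, twice the signed area of the triangle of the
  -- points `(x , y)`.
  det : Fin 4 → Fin 4 → Fin 4 → Carrier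
  det i j k = (x j - x i) * (y k - y i) - (x k - x i) * (y j - y i)

  minor : Vector Carrier 4
  minor 0F = det 1F 2F 3F
  minor 1F = det 0F 2F 3F
  minor 2F = det 0F 1F 3F
  minor 3F = det 0F 1F 2F

  -- Laplace expansion of a 4 by 4 determinant with two equal rows: the three coordinate rows of the
  -- `θ`, with row `d` repeated.
  dependence : ∀ d → sum (λ i → sign i (minor i) * θ i d) ≈ 0#
  dependence 0F = solve 8 (λ a b c d p q r s →
      let det = λ a p b q c r → (b :- a) :* (r :- p) :- (c :- a) :* (q :- p) in
      (det b q c r d s) :* a :+ ((:- det a p c r d s) :* b :+ (det a p b q d s :* c
        :+ ((:- det a p b q c r) :* d :+ con (+ 0)))) := con (+ 0))
    refl (x 0F) (x 1F) (x 2F) (x 3F) (y 0F) (y 1F) (y 2F) (y 3F)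
  dependence 1F = solve 8 (λ a b c d p q r s →
      let det = λ a p b q c r → (b :- a) :* (r :- p) :- (c :- a) :* (q :- p) in
      (det b q c r d s) :* p :+ ((:- det a p c r d s) :* q :+ (det a p b q d s :* r
        :+ ((:- det a p b q c r) :* s :+ con (+ 0)))) := con (+ 0))
    refl (x 0F) (x 1F) (x 2F) (x 3F) (y 0F) (y 1F) (y 2F) (y 3F)
  dependence 2F = solve 8 (λ a b c d p q r s →
      let det = λ a p b q c r → (b :- a) :* (r :- p) :- (c :- a) :* (q :- p) in
      (det b q c r d s) :* con (+ 1) :+ ((:- det a p c r d s) :* con (+ 1) :+ (det a p b q d s :* con (+ 1)
        :+ ((:- det a p b q c r) :* con (+ 1) :+ con (+ 0)))) := con (+ 0))
    refl (x 0F) (x 1F) (x 2F) (x 3F) (y 0F) (y 1F) (y 2F) (y 3F)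

  -- The partial derivatives of `w ∙ point s` in the coordinates `s`; together with `offset` they
  -- describe this affine function, as `∙-point` shows.
  gradient : Point → Vector Carrier 4
  gradient w i = sign i (w ∙ θ i)

  offset : Point → Carrier
  offset w = w ∙ θ 1F + w ∙ θ 3F

  ∙-point : ∀ w s → w ∙ point s ≈ offset w + sum (λ i → gradient w i * s i)
  ∙-point w s = solve 15 (λ a b c d p q r s w₀ w₁ w₂ s₀ s₁ s₂ s₃ →
      let o = con (+ 1)
          z = con (+ 0)
          dot = λ a p → w₀ :* a :+ (w₁ :* p :+ (w₂ :* o :+ z))
          pt = λ a b c d → s₀ :* a :+ ((o :- s₁) :* b :+ (s₂ :* c :+ ((o :- s₃) :* d :+ z)))
      in w₀ :* pt a b c d :+ (w₁ :* pt p q r s :+ (w₂ :* pt o o o o :+ z))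
           := (dot b q :+ dot d s) :+ (dot a p :* s₀ :+ ((:- dot b q) :* s₁ :+ (dot c r :* s₂
               :+ ((:- dot d s) :* s₃ :+ z)))))
    refl (x 0F) (x 1F) (x 2F) (x 3F) (y 0F) (y 1F) (y 2F) (y 3F)
         (w 0F) (w 1F) (w 2F) (s 0F) (s 1F) (s 2F) (s 3F)

  -- Applied to a dependence `c`, whose signed sum vanishes, this shows that moving `s` along `c`
  -- does not move the point.
  point-shift : ∀ (s c : Vector Carrier 4) t d → point (λ i → s i + t * c i) d
                            ≈ point s d + t * sum (λ i → sign i (c i) * θ i d)
  point-shift s c t d = solve 13 (λ s₀ s₁ s₂ s₃ c₀ c₁ c₂ c₃ θ₀ θ₁ θ₂ θ₃ t →
      let o = con (+ 1)
          z = con (+ 0)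
      in (s₀ :+ t :* c₀) :* θ₀ :+ ((o :- (s₁ :+ t :* c₁)) :* θ₁
           :+ ((s₂ :+ t :* c₂) :* θ₂ :+ ((o :- (s₃ :+ t :* c₃)) :* θ₃ :+ z)))
         := (s₀ :* θ₀ :+ ((o :- s₁) :* θ₁ :+ (s₂ :* θ₂ :+ ((o :- s₃) :* θ₃ :+ z))))
            :+ t :* (c₀ :* θ₀ :+ ((:- c₁) :* θ₁ :+ (c₂ :* θ₂ :+ ((:- c₃) :* θ₃ :+ z)))))
    refl (s 0F) (s 1F) (s 2F) (s 3F) (c 0F) (c 1F) (c 2F) (c 3F)
         (θ 0F d) (θ 1F d) (θ 2F d) (θ 3F d) t

  -- Cramer's rule: the combination of the cross products of `θ 0F`, `θ 1F`, `θ 2F` whose gradient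
  -- at these three indices is a prescribed vector, up to the factor `minor 3F`.
  normal : Vector Carrier 4 → Point
  normal ω 0F = ω 0F * (y 1F - y 2F) + - ω 1F * (y 2F - y 0F) + ω 2F * (y 0F - y 1F)
  normal ω 1F = ω 0F * (x 2F - x 1F) + - ω 1F * (x 0F - x 2F) + ω 2F * (x 1F - x 0F)
  normal ω 2F = ω 0F * (x 1F * y 2F - y 1F * x 2F) + - ω 1F * (x 2F * y 0F - y 2F * x 0F)
                + ω 2F * (x 0F * y 1F - y 0F * x 1F)

  -- The first three entries are identities by the choice of `normal`. The last one is then forced,
  -- since by `dependence` every gradient is orthogonal to the minors, as `ω` is assumed to be.
  gradient-normal : ∀ ω → sum (λ i → minor i * ω i) ≈ 0# →
                    ∀ i → gradient (normal ω) i ≈ minor 3F * ω i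
  gradient-normal ω _ 0F = solve 9 (λ a b c p q r ω₀ ω₁ ω₂ →
      let det = λ a p b q c r → (b :- a) :* (r :- p) :- (c :- a) :* (q :- p)
          w₀ = ω₀ :* (q :- r) :+ (:- ω₁) :* (r :- p) :+ ω₂ :* (p :- q)
          w₁ = ω₀ :* (c :- b) :+ (:- ω₁) :* (a :- c) :+ ω₂ :* (b :- a)
          w₂ = ω₀ :* (b :* r :- q :* c) :+ (:- ω₁) :* (c :* p :- r :* a) :+ ω₂ :* (a :* q :- p :* b)
      in w₀ :* a :+ (w₁ :* p :+ (w₂ :* con (+ 1) :+ con (+ 0))) := det a p b q c r :* ω₀)
    refl (x 0F) (x 1F) (x 2F) (y 0F) (y 1F) (y 2F) (ω 0F) (ω 1F) (ω 2F)
  gradient-normal ω _ 1F = solve 9 (λ a b c p q r ω₀ ω₁ ω₂ →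
      let det = λ a p b q c r → (b :- a) :* (r :- p) :- (c :- a) :* (q :- p)
          w₀ = ω₀ :* (q :- r) :+ (:- ω₁) :* (r :- p) :+ ω₂ :* (p :- q)
          w₁ = ω₀ :* (c :- b) :+ (:- ω₁) :* (a :- c) :+ ω₂ :* (b :- a)
          w₂ = ω₀ :* (b :* r :- q :* c) :+ (:- ω₁) :* (c :* p :- r :* a) :+ ω₂ :* (a :* q :- p :* b)
      in :- (w₀ :* b :+ (w₁ :* q :+ (w₂ :* con (+ 1) :+ con (+ 0)))) := det a p b q c r :* ω₁)
    refl (x 0F) (x 1F) (x 2F) (y 0F) (y 1F) (y 2F) (ω 0F) (ω 1F) (ω 2F)
  gradient-normal ω _ 2F = solve 9 (λ a b c p q r ω₀ ω₁ ω₂ →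
      let det = λ a p b q c r → (b :- a) :* (r :- p) :- (c :- a) :* (q :- p)
          w₀ = ω₀ :* (q :- r) :+ (:- ω₁) :* (r :- p) :+ ω₂ :* (p :- q)
          w₁ = ω₀ :* (c :- b) :+ (:- ω₁) :* (a :- c) :+ ω₂ :* (b :- a)
          w₂ = ω₀ :* (b :* r :- q :* c) :+ (:- ω₁) :* (c :* p :- r :* a) :+ ω₂ :* (a :* q :- p :* b)
      in w₀ :* c :+ (w₁ :* r :+ (w₂ :* con (+ 1) :+ con (+ 0))) := det a p b q c r :* ω₂)
    refl (x 0F) (x 1F) (x 2F) (y 0F) (y 1F) (y 2F) (ω 0F) (ω 1F) (ω 2F)
  gradient-normal ω minor∙ω≈0 3F = begin
    gradient (normal ω) 3F                                 ≈⟨ identity ⟩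
    minor 3F * ω 3F - sum (λ i → minor i * ω i)            ≈⟨ +-congˡ (-‿cong minor∙ω≈0) ⟩
    minor 3F * ω 3F - 0#                                   ≈⟨ solve 1 (λ a → a :- con (+ 0) := a) refl _ ⟩
    minor 3F * ω 3F                                        ∎
    where
    identity : gradient (normal ω) 3F ≈ minor 3F * ω 3F - sum (λ i → minor i * ω i)
    identity = solve 12 (λ a b c d p q r s ω₀ ω₁ ω₂ ω₃ →
      let det = λ a p b q c r → (b :- a) :* (r :- p) :- (c :- a) :* (q :- p)
          w₀ = ω₀ :* (q :- r) :+ (:- ω₁) :* (r :- p) :+ ω₂ :* (p :- q)
          w₁ = ω₀ :* (c :- b) :+ (:- ω₁) :* (a :- c) :+ ω₂ :* (b :- a)
          w₂ = ω₀ :* (b :* r :- q :* c) :+ (:- ω₁) :* (c :* p :- r :* a) :+ ω₂ :* (a :* q :- p :* b)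
          m₃ = det a p b q c r
      in :- (w₀ :* d :+ (w₁ :* s :+ (w₂ :* con (+ 1) :+ con (+ 0))))
           := m₃ :* ω₃ :- (det b q c r d s :* ω₀ :+ (det a p c r d s :* ω₁
                :+ (det a p b q d s :* ω₂ :+ (m₃ :* ω₃ :+ con (+ 0))))))
      refl (x 0F) (x 1F) (x 2F) (x 3F) (y 0F) (y 1F) (y 2F) (y 3F)
           (ω 0F) (ω 1F) (ω 2F) (ω 3F)

  -- The two points are the sets 13 and 24. If they coincided, the coefficients 1, -1, 1, -1 would
  -- be an integer relation among the `θ`, against ℤ-independence.
  all-ones≋all-zeros⇒⊥ : ¬ (point (λ _ → 1#) ≋ point (λ _ → 0#))
  all-ones≋all-zeros⇒⊥ ones≋zeros = contradiction (ℤ-independent m dependent 0F) λ ()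
    where
    m : Fin 4 → ℤ
    m 0F = + 1
    m 1F = -[1+ 0 ]
    m 2F = + 1
    m 3F = -[1+ 0 ]

    dependent : ∀ d → sum (λ i → m i ×ℤ θ i d) ≈ 0#
    dependent d = begin
      sum (λ i → m i ×ℤ θ i d)                  ≈⟨ identity ⟩
      point (λ _ → 1#) d - point (λ _ → 0#) d   ≈⟨ +-congʳ (ones≋zeros d) ⟩
      point (λ _ → 0#) d - point (λ _ → 0#) d   ≈⟨ -‿inverseʳ _ ⟩
      0#                                        ∎
      where
      identity : sum (λ i → m i ×ℤ θ i d) ≈ point (λ _ → 1#) d - point (λ _ → 0#) d
      identity = solve 4 (λ a b c d →
          let o = con (+ 1)
              z = con (+ 0)
          in (a :+ z) :+ ((:- (b :+ z)) :+ ((c :+ z) :+ ((:- (d :+ z)) :+ z)))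
             := (o :* a :+ ((o :- o) :* b :+ (o :* c :+ ((o :- o) :* d :+ z))))
                :- (z :* a :+ ((o :- z) :* b :+ (z :* c :+ ((o :- z) :* d :+ z)))))
        refl (θ 0F d) (θ 1F d) (θ 2F d) (θ 3F d)

-- Elementary inequalities in ordered fields

module OrderedFieldProperties {c ℓ₁ ℓ₂} (F : OrderedField c ℓ₁ ℓ₂) where
  open OrderedField F
  open IntegerSolver commutativeRing
  open IsStrictTotalOrder isStrictTotalOrder public
    using (compare; <-respˡ-≈; <-respʳ-≈)
    renaming (trans to <-trans; irrefl to <-irrefl)

  <⇒≉ : ∀ {a b} → a < b → ¬ a ≈ b
  <⇒≉ a<b a≈b = <-irrefl a≈b a<b

  <⇒≱ : ∀ {a b} → a < b → ¬ b ≤ a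
  <⇒≱ a<b (inj₁ b<a) = <-irrefl refl (<-trans a<b b<a)
  <⇒≱ a<b (inj₂ b≈a) = <-irrefl (sym b≈a) a<b

  ≤-respˡ : ∀ {a b d} → a ≈ b → a ≤ d → b ≤ d
  ≤-respˡ a≈b (inj₁ a<d) = inj₁ (<-respˡ-≈ a≈b a<d)
  ≤-respˡ a≈b (inj₂ a≈d) = inj₂ (trans (sym a≈b) a≈d)

  ≤-respʳ : ∀ {a b d} → a ≈ b → d ≤ a → d ≤ b
  ≤-respʳ a≈b (inj₁ d<a) = inj₁ (<-respʳ-≈ a≈b d<a)
  ≤-respʳ a≈b (inj₂ d≈a) = inj₂ (trans d≈a a≈b)

  ≤-antisym : ∀ {a b} → a ≤ b → b ≤ a → a ≈ b
  ≤-antisym (inj₂ a≈b) _   = a≈b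
  ≤-antisym (inj₁ a<b) b≤a = ⊥-elim (<⇒≱ a<b b≤a)

  a<b⇒0<b-a : ∀ {a b} → a < b → 0# < b - a
  a<b⇒0<b-a {a} {b} a<b =
    <-respˡ-≈ (-‿inverseˡ a) (<-respʳ-≈ (+-comm (- a) b) (+-monoʳ-< (- a) a<b))

  0<b-a⇒a<b : ∀ {a b} → 0# < b - a → a < b
  0<b-a⇒a<b {a} {b} 0<b-a =
    <-respˡ-≈ (+-identityʳ a)
      (<-respʳ-≈ (solve 2 (λ a b → a :+ (b :- a) := b) refl a b) (+-monoʳ-< a 0<b-a))

  a≤b⇒0≤b-a : ∀ {a b} → a ≤ b → 0# ≤ b - a
  a≤b⇒0≤b-a     (inj₁ a<b) = inj₁ (a<b⇒0<b-a a<b)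
  a≤b⇒0≤b-a {a} (inj₂ a≈b) = inj₂ (trans (sym (-‿inverseʳ a)) (+-congʳ a≈b))

  0≤b-a⇒a≤b : ∀ {a b} → 0# ≤ b - a → a ≤ b
  0≤b-a⇒a≤b         (inj₁ 0<b-a) = inj₁ (0<b-a⇒a<b 0<b-a)
  0≤b-a⇒a≤b {a} {b} (inj₂ 0≈b-a) = inj₂
    (trans (sym (+-identityʳ a))
      (trans (+-congˡ 0≈b-a) (solve 2 (λ a b → a :+ (b :- a) := b) refl a b)))

  +-positive : ∀ {a b} → 0# < a → 0# ≤ b → 0# < a + b
  +-positive {a} 0<a (inj₁ 0<b) = <-trans 0<a (<-respˡ-≈ (+-identityʳ a) (+-monoʳ-< a 0<b))
  +-positive {a} 0<a (inj₂ 0≈b) = <-respʳ-≈ (trans (sym (+-identityʳ a)) (+-congˡ 0≈b)) 0<a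

  +-nonNegative : ∀ {a b} → 0# ≤ a → 0# ≤ b → 0# ≤ a + b
  +-nonNegative         (inj₁ 0<a) 0≤b = inj₁ (+-positive 0<a 0≤b)
  +-nonNegative {a} {b} (inj₂ 0≈a) 0≤b =
    ≤-respʳ (trans (sym (+-identityˡ b)) (+-congʳ 0≈a)) 0≤b

  +-zero : ∀ {a b} → 0# ≤ a → 0# ≤ b → 0# ≈ a + b → 0# ≈ a × 0# ≈ b
  +-zero         (inj₁ 0<a) 0≤b 0≈a+b = ⊥-elim (<⇒≉ (+-positive 0<a 0≤b) 0≈a+b)
  +-zero {a} {b} (inj₂ 0≈a) 0≤b 0≈a+b =
    0≈a , trans 0≈a+b (trans (+-congʳ (sym 0≈a)) (+-identityˡ b))

  neg-positive : ∀ {a} → a < 0# → 0# < - a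
  neg-positive a<0 = <-respʳ-≈ (+-identityˡ _) (a<b⇒0<b-a a<0)

  *-nonNegative : ∀ {a b} → 0# < a → 0# ≤ b → 0# ≤ a * b
  *-nonNegative     0<a (inj₁ 0<b) = inj₁ (*-positive 0<a 0<b)
  *-nonNegative {a} 0<a (inj₂ 0≈b) = inj₂ (trans (sym (zeroʳ a)) (*-congˡ 0≈b))

  -- If `1#` were negative, it would be the square of the positive element `- 1#`.
  0<1 : 0# < 1#
  0<1 with compare 0# 1#
  ... | tri< 0<1 _ _ = 0<1
  ... | tri≈ _ 0≈1 _ = ⊥-elim (0≉1 0≈1)
  ... | tri> _ _ 1<0 = <-respʳ-≈ (solve 0 ((:- con (+ 1)) :* (:- con (+ 1)) := con (+ 1)) refl)
    (*-positive (neg-positive 1<0) (neg-positive 1<0))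

  *-neg : ∀ {a b} → 0# < a → b < 0# → a * b < 0#
  *-neg {a} {b} 0<a b<0 = 0<b-a⇒a<b
    (<-respʳ-≈ (solve 2 (λ a b → a :* (:- b) := con (+ 0) :- a :* b) refl a b)
      (*-positive 0<a (neg-positive b<0)))

  *-cancel-positive : ∀ {a b} → 0# < a → 0# < a * b → 0# < b
  *-cancel-positive {a} {b} 0<a 0<ab with compare 0# b
  ... | tri< 0<b _ _ = 0<b
  ... | tri≈ _ 0≈b _ = ⊥-elim (<⇒≉ 0<ab (trans (sym (zeroʳ a)) (*-congˡ 0≈b)))
  ... | tri> _ _ b<0 = ⊥-elim (<-irrefl refl (<-trans 0<ab (*-neg 0<a b<0)))

  *-cancel-zero : ∀ {a b} → 0# < a → 0# ≈ a * b → 0# ≈ b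
  *-cancel-zero {a} {b} 0<a 0≈ab with compare 0# b
  ... | tri< 0<b _ _ = ⊥-elim (<⇒≉ (*-positive 0<a 0<b) 0≈ab)
  ... | tri≈ _ 0≈b _ = 0≈b
  ... | tri> _ _ b<0 = ⊥-elim (<⇒≉ (*-neg 0<a b<0) (sym 0≈ab))

  positive-inverse : ∀ {a} → 0# < a → ∃[ b ] (0# < b × a * b ≈ 1#)
  positive-inverse {a} 0<a with inverse a (λ a≈0 → <⇒≉ 0<a (sym a≈0))
  ... | b , ab≈1 = b , *-cancel-positive 0<a (<-respʳ-≈ (sym ab≈1) 0<1) , ab≈1

-- Positivity and normalisation of the dependence

-- The affine dependence of the four vectors, scaled so that its coefficients
-- sum to 1; `separator` provides every functional that vanishes on it.
record Balance {c ℓ₁ ℓ₂} (F : OrderedField c ℓ₁ ℓ₂) (Θ : Configuration F 4)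
       : Set (c ⊔ ℓ₁ ⊔ ℓ₂) where
  open OrderedField F
  open Space F
  open Configuration Θ
  open Coordinates F Θ

  field
    weight            : Vector Carrier 4
    0<weight          : ∀ i → 0# < weight i
    sum-weight        : sum weight ≈ 1#
    weight-dependence : ∀ d → sum (λ i → sign i (weight i) * θ i d) ≈ 0#
    separator         : ∀ (v : Vector Carrier 4) →
      ∃[ w ] (∀ i → gradient w i ≈ v i - sum (λ j → v j * weight j))

module _ {c ℓ₁ ℓ₂} (F : OrderedField c ℓ₁ ℓ₂) (Θ : Configuration F 4) where
  open OrderedField F
  open OrderedFieldProperties F
  open Space F
  open Configuration Θ
  open Coordinates F Θ
  open IntegerSolver commutativeRing
  open SetoidReasoning setoid

  -- For `t` the ratio of `x j - x i` to `x k - x i`, the gap granted by `lower-chain`, multiplied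
  -- by `x k - x i`, is exactly the determinant.
  det-positive : ∀ {i j k} → i Fin.< j → j Fin.< k → 0# < det i j k
  det-positive {i} {j} {k} i<j j<k = <-respʳ-≈ scaled-gap
    (*-positive 0<u (a<b⇒0<b-a (lower-chain i<j j<k t (0≤t , t≤1) x-split)))
    where
    u v : Carrier
    u = x k - x i
    v = x j - x i

    0<v : 0# < v
    0<v = a<b⇒0<b-a (x-increasing i<j)

    0<u-v : 0# < u - v
    0<u-v = <-respʳ-≈
      (solve 3 (λ a b c → c :- b := (c :- a) :- (b :- a)) refl (x i) (x j) (x k))
      (a<b⇒0<b-a (x-increasing j<k))

    0<u : 0# < u
    0<u = <-trans 0<v (0<b-a⇒a<b 0<u-v)

    u⁻¹ t : Carrier
    u⁻¹ = proj₁ (positive-inverse 0<u)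
    t   = v * u⁻¹

    0<u⁻¹ : 0# < u⁻¹
    0<u⁻¹ = proj₁ (proj₂ (positive-inverse 0<u))

    u*u⁻¹≈1 : u * u⁻¹ ≈ 1#
    u*u⁻¹≈1 = proj₂ (proj₂ (positive-inverse 0<u))

    0≤t : 0# ≤ t
    0≤t = inj₁ (*-positive 0<v 0<u⁻¹)

    t≤1 : t ≤ 1#
    t≤1 = 0≤b-a⇒a≤b (inj₁ (<-respʳ-≈
      (begin
        (u - v) * u⁻¹     ≈⟨ solve 3 (λ u v r → (u :- v) :* r := u :* r :- v :* r) refl u v u⁻¹ ⟩
        u * u⁻¹ - t       ≈⟨ +-congʳ u*u⁻¹≈1 ⟩
        1# - t            ∎)
      (*-positive 0<u-v 0<u⁻¹)))

    u*t≈v : u * t ≈ v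
    u*t≈v = begin
      u * (v * u⁻¹)   ≈⟨ solve 3 (λ u v r → u :* (v :* r) := u :* r :* v) refl u v u⁻¹ ⟩
      u * u⁻¹ * v     ≈⟨ *-congʳ u*u⁻¹≈1 ⟩
      1# * v          ≈⟨ *-identityˡ v ⟩
      v               ∎

    x-split : x j ≈ (1# - t) * x i + t * x k
    x-split = begin
      x j                            ≈⟨ solve 2 (λ a b → b := a :+ (b :- a)) refl (x i) (x j) ⟩
      x i + v                        ≈⟨ +-congˡ u*t≈v ⟨
      x i + u * t                    ≈⟨ solve 3 (λ a c t → a :+ (c :- a) :* t
                                          := (con (+ 1) :- t) :* a :+ t :* c) refl (x i) (x k) t ⟩
      (1# - t) * x i + t * x k       ∎

    scaled-gap : u * ((1# - t) * y i + t * y k - y j) ≈ det i j k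
    scaled-gap = begin
      u * ((1# - t) * y i + t * y k - y j)           ≈⟨ solve 5 (λ u t p q r →
                                                          u :* ((con (+ 1) :- t) :* p :+ t :* r :- q)
                                                          := (u :* t) :* (r :- p) :- u :* (q :- p))
                                                          refl u t (y i) (y j) (y k) ⟩
      (u * t) * (y k - y i) - u * (y j - y i)        ≈⟨ +-congʳ (*-congʳ u*t≈v) ⟩
      v * (y k - y i) - u * (y j - y i)              ∎

  minor-positive : ∀ i → 0# < minor i
  minor-positive 0F = det-positive {1F} {2F} {3F} (s≤s (s≤s z≤n)) (s≤s (s≤s (s≤s z≤n)))
  minor-positive 1F = det-positive {0F} {2F} {3F} (s≤s z≤n) (s≤s (s≤s (s≤s z≤n)))
  minor-positive 2F = det-positive {0F} {1F} {3F} (s≤s z≤n) (s≤s (s≤s z≤n))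
  minor-positive 3F = det-positive {0F} {1F} {2F} (s≤s z≤n) (s≤s (s≤s z≤n))

  balance : Balance F Θ
  balance = normalise minor minor-positive dependence gradient-normal
    where
    -- Generalising over the minors keeps the solver from expanding them.
    normalise : (m : Vector Carrier 4) → (∀ i → 0# < m i) →
                (∀ d → sum (λ i → sign i (m i) * θ i d) ≈ 0#) →
                (∀ ω → sum (λ i → m i * ω i) ≈ 0# → ∀ i → gradient (normal ω) i ≈ m 3F * ω i) →
                Balance F Θ
    normalise m 0<m m-dependence m-normal = record
      { weight            = λ i → m i * total⁻¹
      ; 0<weight          = λ i → *-positive (0<m i) (proj₁ (proj₂ (positive-inverse 0<total)))
      ; sum-weight        = trans (sum-scale m) total*total⁻¹≈1
      ; weight-dependence = λ d → begin
          sum (λ i → sign i (m i * total⁻¹) * θ i d)   ≈⟨ dependence-scale d ⟩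
          sum (λ i → sign i (m i) * θ i d) * total⁻¹   ≈⟨ *-congʳ (m-dependence d) ⟩
          0# * total⁻¹                                 ≈⟨ zeroˡ _ ⟩
          0#                                           ∎
      ; separator         = λ v → normal (ω v) , λ i → begin
          gradient (normal (ω v)) i       ≈⟨ m-normal (ω v) (ω-orthogonal v) i ⟩
          m 3F * (α v i * m₃⁻¹)           ≈⟨ solve 3 (λ m a r → m :* (a :* r) := m :* r :* a) refl (m 3F) (α v i) m₃⁻¹ ⟩
          m 3F * m₃⁻¹ * α v i             ≈⟨ *-congʳ m₃*m₃⁻¹≈1 ⟩
          1# * α v i                      ≈⟨ *-identityˡ _ ⟩
          α v i                           ∎
      }
      where
      total : Carrier
      total = sum m

      0<total : 0# < total
      0<total = +-positive (0<m 0F) (inj₁ (+-positive (0<m 1F) (inj₁ (+-positive (0<m 2F)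
                  (inj₁ (+-positive (0<m 3F) (inj₂ refl)))))))

      total⁻¹ m₃⁻¹ : Carrier
      total⁻¹ = proj₁ (positive-inverse 0<total)
      m₃⁻¹    = proj₁ (positive-inverse (0<m 3F))

      total*total⁻¹≈1 : total * total⁻¹ ≈ 1#
      total*total⁻¹≈1 = proj₂ (proj₂ (positive-inverse 0<total))

      m₃*m₃⁻¹≈1 : m 3F * m₃⁻¹ ≈ 1#
      m₃*m₃⁻¹≈1 = proj₂ (proj₂ (positive-inverse (0<m 3F)))

      sum-scale : ∀ (a : Vector Carrier 4) → sum (λ i → a i * total⁻¹) ≈ sum a * total⁻¹
      sum-scale a = solve 5 (λ a b c d r →
          a :* r :+ (b :* r :+ (c :* r :+ (d :* r :+ con (+ 0))))
          := (a :+ (b :+ (c :+ (d :+ con (+ 0))))) :* r)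
        refl (a 0F) (a 1F) (a 2F) (a 3F) total⁻¹

      dependence-scale : ∀ d → sum (λ i → sign i (m i * total⁻¹) * θ i d)
                               ≈ sum (λ i → sign i (m i) * θ i d) * total⁻¹
      dependence-scale d = solve 9 (λ m₀ m₁ m₂ m₃ a b c d r →
          m₀ :* r :* a :+ ((:- (m₁ :* r)) :* b :+ (m₂ :* r :* c :+ ((:- (m₃ :* r)) :* d :+ con (+ 0))))
          := (m₀ :* a :+ ((:- m₁) :* b :+ (m₂ :* c :+ ((:- m₃) :* d :+ con (+ 0))))) :* r)
        refl (m 0F) (m 1F) (m 2F) (m 3F) (θ 0F d) (θ 1F d) (θ 2F d) (θ 3F d) total⁻¹

      -- Subtracting the weighted mean makes `v` orthogonal to the minors, because the weights sum
      -- to 1. The division by `m 3F` cancels the factor left by Cramer's rule.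
      α ω : Vector Carrier 4 → Vector Carrier 4
      α v i = v i - sum (λ j → v j * (m j * total⁻¹))
      ω v i = α v i * m₃⁻¹

      ω-orthogonal : ∀ v → sum (λ i → m i * ω v i) ≈ 0#
      ω-orthogonal v = begin
        sum (λ i → m i * ω v i)
          ≈⟨ solve 10 (λ a b c d m₀ m₁ m₂ m₃ r q →
               let z  = con (+ 0)
                   μ  = a :* (m₀ :* r) :+ (b :* (m₁ :* r) :+ (c :* (m₂ :* r) :+ (d :* (m₃ :* r) :+ z)))
                   M  = m₀ :+ (m₁ :+ (m₂ :+ (m₃ :+ z)))
               in m₀ :* ((a :- μ) :* q) :+ (m₁ :* ((b :- μ) :* q) :+ (m₂ :* ((c :- μ) :* q)
                    :+ (m₃ :* ((d :- μ) :* q) :+ z)))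
                  := (con (+ 1) :- M :* r) :* ((a :* m₀ :+ (b :* m₁ :+ (c :* m₂ :+ d :* m₃))) :* q))
               refl (v 0F) (v 1F) (v 2F) (v 3F) (m 0F) (m 1F) (m 2F) (m 3F) total⁻¹ m₃⁻¹ ⟩
        (1# - total * total⁻¹) * _      ≈⟨ *-congʳ (+-congˡ (-‿cong total*total⁻¹≈1)) ⟩
        (1# - 1#) * _                   ≈⟨ *-congʳ (-‿inverseʳ 1#) ⟩
        0# * _                          ≈⟨ zeroˡ _ ⟩
        0#                              ∎

-- Fibres of the projection and facets of the 4-cube

third-index : ∀ (i j : Fin 4) → ∃[ k ] (k ≢ i × k ≢ j)
third-index = toWitness {a? = all? λ i → all? λ j → any? λ k → ¬? (k ≟ i) ×-dec ¬? (k ≟ j)} _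

module Facets {c ℓ₁ ℓ₂} {F : OrderedField c ℓ₁ ℓ₂} {Θ : Configuration F 4}
              (K : Balance F Θ) where
  open OrderedField F
  open OrderedFieldProperties F
  open Space F
  open Configuration Θ
  open Coordinates F Θ
  open Balance K
  open IntegerSolver commutativeRing
  open Sums +-commutativeMonoid using (sum-cong-≋; sum-remove)
  open RingProperties ring using (+-cancelˡ)
  open SetoidReasoning setoid

  sum-nonNegative : ∀ {n} (f : Vector Carrier n) → (∀ i → 0# ≤ f i) → 0# ≤ sum f
  sum-nonNegative {0}         f 0≤f = inj₂ refl
  sum-nonNegative {ℕ.suc n} f 0≤f =
    +-nonNegative (0≤f Fin.zero) (sum-nonNegative (f ∘ Fin.suc) (0≤f ∘ Fin.suc))

  sum-positive : ∀ {n} (f : Vector Carrier (ℕ.suc n)) → (∀ i → 0# ≤ f i) →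
                 ∀ i → 0# < f i → 0# < sum f
  sum-positive f 0≤f i 0<fi = <-respʳ-≈ (sym (sum-remove {i = i} f))
    (+-positive 0<fi (sum-nonNegative _ (0≤f ∘ punchIn i)))

  sum-zero : ∀ {n} (f : Vector Carrier n) → (∀ i → 0# ≤ f i) → 0# ≈ sum f → ∀ i → 0# ≈ f i
  sum-zero f 0≤f 0≈∑ Fin.zero    = proj₁ (+-zero (0≤f Fin.zero) (sum-nonNegative _ (0≤f ∘ Fin.suc)) 0≈∑)
  sum-zero f 0≤f 0≈∑ (Fin.suc i) = sum-zero (f ∘ Fin.suc) (0≤f ∘ Fin.suc)
    (proj₂ (+-zero (0≤f Fin.zero) (sum-nonNegative _ (0≤f ∘ Fin.suc)) 0≈∑)) i

  ≋-sym : ∀ {p q : Point} → p ≋ q → q ≋ p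
  ≋-sym p≋q d = sym (p≋q d)

  ≋-trans : ∀ {p q r : Point} → p ≋ q → q ≋ r → p ≋ r
  ≋-trans p≋q q≋r d = trans (p≋q d) (q≋r d)

  ∙-congˡ-≋ : ∀ w {p q} → p ≋ q → w ∙ p ≈ w ∙ q
  ∙-congˡ-≋ w p≋q = sum-cong-≋ (λ d → *-congˡ {x = w d} (p≋q d))

  flip-cong : ∀ i {a b} → a ≈ b → flip i a ≈ flip i b
  flip-cong 0F a≈b = a≈b
  flip-cong 1F a≈b = +-congˡ (-‿cong a≈b)
  flip-cong 2F a≈b = a≈b
  flip-cong 3F a≈b = +-congˡ (-‿cong a≈b)

  point-cong : ∀ {s t : Vector Carrier 4} → (∀ i → s i ≈ t i) → point s ≋ point t
  point-cong s≈t d = sum-cong-≋ (λ i → *-congʳ {x = θ i d} (flip-cong i (s≈t i)))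

  -- Coordinates along which the gradient vanishes may differ freely.
  ∙-point-cong : ∀ w s t → (∀ i → gradient w i * s i ≈ gradient w i * t i) →
                 w ∙ point s ≈ w ∙ point t
  ∙-point-cong w s t eq =
    trans (∙-point w s) (trans (+-congˡ (sum-cong-≋ eq)) (sym (∙-point w t)))

  δ : Fin 4 → Vector Carrier 4
  δ i = updateAt (λ _ → 0#) i (λ _ → 1#)

  sum-δ : ∀ i (s : Vector Carrier 4) → sum (λ j → δ i j * s j) ≈ s i
  sum-δ 0F s = solve 4 (λ a b c d → let o = con (+ 1) ; z = con (+ 0) in
    o :* a :+ (z :* b :+ (z :* c :+ (z :* d :+ z))) := a) refl (s 0F) (s 1F) (s 2F) (s 3F)
  sum-δ 1F s = solve 4 (λ a b c d → let o = con (+ 1) ; z = con (+ 0) in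
    z :* a :+ (o :* b :+ (z :* c :+ (z :* d :+ z))) := b) refl (s 0F) (s 1F) (s 2F) (s 3F)
  sum-δ 2F s = solve 4 (λ a b c d → let o = con (+ 1) ; z = con (+ 0) in
    z :* a :+ (z :* b :+ (o :* c :+ (z :* d :+ z))) := c) refl (s 0F) (s 1F) (s 2F) (s 3F)
  sum-δ 3F s = solve 4 (λ a b c d → let o = con (+ 1) ; z = con (+ 0) in
    z :* a :+ (z :* b :+ (z :* c :+ (o :* d :+ z))) := d) refl (s 0F) (s 1F) (s 2F) (s 3F)

  sum-shift : ∀ (v : Vector Carrier 4) m (s : Vector Carrier 4) →
              sum (λ j → (v j - m) * s j) ≈ sum (λ j → v j * s j) - m * sum s
  sum-shift v m s = solve 9 (λ a b c d p q r u m → let z = con (+ 0) in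
      (a :- m) :* p :+ ((b :- m) :* q :+ ((c :- m) :* r :+ ((d :- m) :* u :+ z)))
      := (a :* p :+ (b :* q :+ (c :* r :+ (d :* u :+ z)))) :- m :* (p :+ (q :+ (r :+ (u :+ z)))))
    refl (v 0F) (v 1F) (v 2F) (v 3F) (s 0F) (s 1F) (s 2F) (s 3F) m

  -- The functional separating `δ i` reads off `s i - weight i * sum s` from the point alone.
  -- Equating this quantity for `s` and `t` gives the difference in coordinate `i` as `weight i`
  -- times the difference of the sums.
  fibre : ∀ s t → point s ≋ point t → ∃[ μ ] (∀ i → t i ≈ s i + weight i * μ)
  fibre s t s≋t = sum t - sum s , λ i → begin
    t i                                                       ≈⟨ solve 4 (λ a w S T → a := (a :- w :* T) :+ w :* T) refl (t i) (weight i) (sum s) (sum t) ⟩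
    t i - weight i * sum t + weight i * sum t                 ≈⟨ +-congʳ (level i) ⟨
    s i - weight i * sum s + weight i * sum t                 ≈⟨ solve 4 (λ a w S T → (a :- w :* S) :+ w :* T := a :+ w :* (T :- S)) refl (s i) (weight i) (sum s) (sum t) ⟩
    s i + weight i * (sum t - sum s)                          ∎
    where
    module _ (i : Fin 4) where
      w : Point
      w = proj₁ (separator (δ i))

      height : ∀ s → w ∙ point s ≈ offset w + (s i - weight i * sum s)
      height s = begin
        w ∙ point s                                                ≈⟨ ∙-point w s ⟩
        offset w + sum (λ j → gradient w j * s j)                  ≈⟨ +-congˡ (sum-cong-≋ (λ j → *-congʳ {x = s j} (proj₂ (separator (δ i)) j))) ⟩
        offset w + sum (λ j → (δ i j - sum (λ k → δ i k * weight k)) * s j)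
                                                                   ≈⟨ +-congˡ (sum-shift (δ i) _ s) ⟩
        offset w + (sum (λ j → δ i j * s j) - sum (λ k → δ i k * weight k) * sum s)
                                                                   ≈⟨ +-congˡ (+-cong (sum-δ i s) (-‿cong (*-congʳ (sum-δ i weight)))) ⟩
        offset w + (s i - weight i * sum s)                        ∎

      level : s i - weight i * sum s ≈ t i - weight i * sum t
      level = +-cancelˡ (offset w) _ _
        (trans (sym (height s)) (trans (∙-congˡ-≋ w s≋t) (height t)))

  -- The fibre is a line with positive direction, so one increasing coordinate makes the factor `μ`
  -- positive and all coordinates increase.
  rises : ∀ s t → point s ≋ point t → ∀ {m} → s m < t m → ∀ i → s i < t i
  rises s t s≋t {m} sm<tm i = 0<b-a⇒a<b (<-respʳ-≈ (sym (gap i)) (*-positive (0<weight i) 0<μ))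
    where
    μ : Carrier
    μ = proj₁ (fibre s t s≋t)

    t≈s+wμ : ∀ i → t i ≈ s i + weight i * μ
    t≈s+wμ = proj₂ (fibre s t s≋t)

    gap : ∀ i → t i - s i ≈ weight i * μ
    gap i = trans (+-congʳ (t≈s+wμ i)) (solve 2 (λ a b → a :+ b :- a := b) refl (s i) (weight i * μ))

    0<μ : 0# < μ
    0<μ = *-cancel-positive (0<weight m) (<-respʳ-≈ (gap m) (a<b⇒0<b-a sm<tm))

  agrees : ∀ s t → point s ≋ point t → ∀ {m} → s m ≈ t m → ∀ i → s i ≈ t i
  agrees s t s≋t {m} sm≈tm i with compare (s i) (t i)
  ... | tri< si<ti _ _ = ⊥-elim (<⇒≉ (rises s t s≋t si<ti m) sm≈tm)
  ... | tri≈ _ si≈ti _ = si≈ti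
  ... | tri> _ _ ti<si = ⊥-elim (<⇒≉ (rises t s (≋-sym s≋t) ti<si m) (sym sm≈tm))

  bit : Bool → Carrier
  bit b = if b then 1# else 0#

  Unit : Vector Carrier 4 → Set (ℓ₁ ⊔ ℓ₂)
  Unit s = ∀ i → InUnitInterval (s i)

  unit-bit : ∀ b → InUnitInterval (bit b)
  unit-bit true  = inj₁ 0<1 , inj₂ refl
  unit-bit false = inj₂ refl , inj₁ 0<1

  set : Vector Carrier 4 → Fin 4 → Carrier → Vector Carrier 4
  set s i a = updateAt s i (λ _ → a)

  set-same : ∀ s i a → set s i a i ≈ a
  set-same s i a = reflexive (updateAt-updates i s)

  set-other : ∀ s {i j} a → j ≢ i → set s i a j ≈ s j
  set-other s {i} {j} a j≢i = reflexive (updateAt-minimal j i s j≢i)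

  unit-resp : ∀ {a b} → a ≈ b → InUnitInterval b → InUnitInterval a
  unit-resp a≈b (0≤b , b≤1) = ≤-respʳ (sym a≈b) 0≤b , ≤-respˡ (sym a≈b) b≤1

  unit-set : ∀ {s} → Unit s → ∀ i {a} → InUnitInterval a → Unit (set s i a)
  unit-set {s} us i {a} ua j with j ≟ i
  ... | yes ≡.refl = unit-resp (set-same s i a) ua
  ... | no j≢i     = unit-resp (set-other s a j≢i) (us j)

  -- The other three weights are positive and all four sum to 1.
  weight<1 : ∀ i → weight i < 1#
  weight<1 i = 0<b-a⇒a<b (<-respʳ-≈
    (begin
      sum rest                       ≈⟨ solve 2 (λ a b → b := (a :+ b) :- a) refl (weight i) (sum rest) ⟩
      weight i + sum rest - weight i ≈⟨ +-congʳ (sum-remove {i = i} weight) ⟨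
      sum weight - weight i          ≈⟨ +-congʳ sum-weight ⟩
      1# - weight i                  ∎)
    (sum-positive rest (λ j → inj₁ (0<weight (punchIn i j))) 0F (0<weight (punchIn i 0F))))
    where
    rest : Vector Carrier 3
    rest = weight ∘ punchIn i

  unit-weight : Unit weight
  unit-weight i = inj₁ (0<weight i) , inj₁ (weight<1 i)

  -- The image of a facet of the unit 4-cube, upper for `true` and lower for `false`; by
  -- `cube-facet` every cube has this form.
  Facet : Fin 4 → Bool → Point → Set (c ⊔ ℓ₁ ⊔ ℓ₂)
  Facet m b p = ∃[ s ] (Unit s × s m ≈ bit b × p ≋ point s)

  ∙-point-set : ∀ w s i a → w ∙ point (set s i a) ≈ w ∙ point s + gradient w i * (a - s i)
  ∙-point-set w s i a = begin
    w ∙ point (set s i a)                                          ≈⟨ ∙-point w (set s i a) ⟩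
    offset w + sum (λ j → gradient w j * set s i a j)              ≈⟨ +-congˡ (sum-set i (gradient w) s) ⟩
    offset w + (sum (λ j → gradient w j * s j) + gradient w i * (a - s i))
                                                                   ≈⟨ +-assoc _ _ _ ⟨
    offset w + sum (λ j → gradient w j * s j) + gradient w i * (a - s i)
                                                                   ≈⟨ +-congʳ (∙-point w s) ⟨
    w ∙ point s + gradient w i * (a - s i)                         ∎
    where
    sum-set : ∀ i (g s : Vector Carrier 4) →
              sum (λ j → g j * set s i a j) ≈ sum (λ j → g j * s j) + g i * (a - s i)
    sum-set 0F g s = solve 9 (λ g₀ g₁ g₂ g₃ s₀ s₁ s₂ s₃ a → let z = con (+ 0) in
        g₀ :* a :+ (g₁ :* s₁ :+ (g₂ :* s₂ :+ (g₃ :* s₃ :+ z)))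
        := (g₀ :* s₀ :+ (g₁ :* s₁ :+ (g₂ :* s₂ :+ (g₃ :* s₃ :+ z)))) :+ g₀ :* (a :- s₀))
      refl (g 0F) (g 1F) (g 2F) (g 3F) (s 0F) (s 1F) (s 2F) (s 3F) a
    sum-set 1F g s = solve 9 (λ g₀ g₁ g₂ g₃ s₀ s₁ s₂ s₃ a → let z = con (+ 0) in
        g₀ :* s₀ :+ (g₁ :* a :+ (g₂ :* s₂ :+ (g₃ :* s₃ :+ z)))
        := (g₀ :* s₀ :+ (g₁ :* s₁ :+ (g₂ :* s₂ :+ (g₃ :* s₃ :+ z)))) :+ g₁ :* (a :- s₁))
      refl (g 0F) (g 1F) (g 2F) (g 3F) (s 0F) (s 1F) (s 2F) (s 3F) a
    sum-set 2F g s = solve 9 (λ g₀ g₁ g₂ g₃ s₀ s₁ s₂ s₃ a → let z = con (+ 0) in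
        g₀ :* s₀ :+ (g₁ :* s₁ :+ (g₂ :* a :+ (g₃ :* s₃ :+ z)))
        := (g₀ :* s₀ :+ (g₁ :* s₁ :+ (g₂ :* s₂ :+ (g₃ :* s₃ :+ z)))) :+ g₂ :* (a :- s₂))
      refl (g 0F) (g 1F) (g 2F) (g 3F) (s 0F) (s 1F) (s 2F) (s 3F) a
    sum-set 3F g s = solve 9 (λ g₀ g₁ g₂ g₃ s₀ s₁ s₂ s₃ a → let z = con (+ 0) in
        g₀ :* s₀ :+ (g₁ :* s₁ :+ (g₂ :* s₂ :+ (g₃ :* a :+ z)))
        := (g₀ :* s₀ :+ (g₁ :* s₁ :+ (g₂ :* s₂ :+ (g₃ :* s₃ :+ z)))) :+ g₃ :* (a :- s₃))
      refl (g 0F) (g 1F) (g 2F) (g 3F) (s 0F) (s 1F) (s 2F) (s 3F) a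

  -- Coordinate `i` can be moved to 0 or to 1 without leaving the facet. A maximum attained strictly
  -- between these ends leaves no slope in either direction.
  interior⇒flat : ∀ {m b} w {β} → (∀ {p} → Facet m b p → w ∙ p ≤ β) →
                  ∀ s → Unit s → s m ≈ bit b → w ∙ point s ≈ β →
                  ∀ {i} → i ≢ m → 0# < s i → s i < 1# → gradient w i ≈ 0#
  interior⇒flat {m} {b} w {β} valid s us sm≈b ws≈β {i} i≢m 0<si si<1 =
    ≤-antisym
      (g≤0 (compare 0# g))
      (0≤g (compare 0# g))
    where
    g : Carrier
    g = gradient w i

    slope≤0 : ∀ a → InUnitInterval a → ¬ (0# < g * (a - s i))
    slope≤0 a ua 0<slope = <⇒≱
      (<-respˡ-≈ (+-identityʳ β) (+-monoʳ-< β 0<slope))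
      (≤-respˡ (trans (∙-point-set w s i a) (+-congʳ ws≈β))
        (valid (set s i a , unit-set us i ua , trans (set-other s a (λ m≡i → i≢m (≡.sym m≡i))) sm≈b
               , λ _ → refl)))

    g≤0 : _ → g ≤ 0#
    g≤0 (tri< 0<g _ _) = ⊥-elim (slope≤0 1# (unit-bit true) (*-positive 0<g (a<b⇒0<b-a si<1)))
    g≤0 (tri≈ _ 0≈g _) = inj₂ (sym 0≈g)
    g≤0 (tri> _ _ g<0) = inj₁ g<0

    0≤g : _ → 0# ≤ g
    0≤g (tri< 0<g _ _) = inj₁ 0<g
    0≤g (tri≈ _ 0≈g _) = inj₂ 0≈g
    0≤g (tri> _ _ g<0) = ⊥-elim (slope≤0 0# (unit-bit false)
      (<-respʳ-≈ (solve 2 (λ g s → (:- g) :* s := g :* (con (+ 0) :- s)) refl g (s i))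
        (*-positive (neg-positive g<0) 0<si)))

-- Conflicts between facets, points and vertices

module Exclusion {c ℓ₁ ℓ₂} {F : OrderedField c ℓ₁ ℓ₂} {Θ : Configuration F 4}
                 (K : Balance F Θ) where
  open OrderedField F
  open OrderedFieldProperties F
  open Space F
  open Configuration Θ
  open Coordinates F Θ
  open Balance K
  open Facets K
  open IntegerSolver commutativeRing
  open SetoidReasoning setoid

  bit-not : ∀ b → ¬ bit b ≈ bit (not b)
  bit-not true  1≈0 = 0≉1 (sym 1≈0)
  bit-not false 0≈1 = 0≉1 0≈1

  -- The point with kth coordinate 1 and all others equal to the weights lies on
  -- the same fibre as a point with only the kth coordinate nonzero; being interior
  -- to the facet sₖ = 1, it would force that whole facet into the other one.
  upper-lower-overlap : ∀ {P P′ : Region} {k j} → P ≐ Facet k true → P′ ≐ Facet j false →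
                        j ≢ k → ¬ IsFace P (P ∩ P′)
  upper-lower-overlap {P} {P′} {k} {j} (P⊆ , ⊆P) (P′⊆ , ⊆P′) j≢k (w , β , valid , face⊆ , ⊆face) =
    <⇒≱ (<-respʳ-≈ (set-same ones i 0#) (rises q′ q (≋-sym q≋q′) {j} q′j<qj i)) (proj₁ (uq′ i))
    where
    ones s s′ : Vector Carrier 4
    ones = λ _ → 1#
    s    = set weight k 1#
    s′   = set (λ _ → 0#) k (1# - weight k)

    us : Unit s
    us = unit-set unit-weight k (unit-bit true)

    us′ : Unit s′
    us′ = unit-set (λ _ → unit-bit false) k
      ( a≤b⇒0≤b-a (proj₂ (unit-weight k))
      , 0≤b-a⇒a≤b (≤-respʳ (solve 1 (λ a → a := con (+ 1) :- (con (+ 1) :- a)) refl (weight k))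
          (proj₁ (unit-weight k))))

    s≈s′+weight : ∀ i → s i ≈ s′ i + 1# * weight i
    s≈s′+weight i with i ≟ k
    ... | yes ≡.refl = begin
      s k                               ≈⟨ set-same weight k 1# ⟩
      1#                                ≈⟨ solve 1 (λ a → con (+ 1) := con (+ 1) :- a :+ con (+ 1) :* a) refl (weight k) ⟩
      1# - weight k + 1# * weight k     ≈⟨ +-congʳ (set-same (λ _ → 0#) k _) ⟨
      s′ k + 1# * weight k              ∎
    ... | no i≢k = begin
      s i                               ≈⟨ set-other weight 1# i≢k ⟩
      weight i                          ≈⟨ solve 1 (λ a → a := con (+ 0) :+ con (+ 1) :* a) refl (weight i) ⟩
      0# + 1# * weight i                ≈⟨ +-congʳ (set-other (λ _ → 0#) _ i≢k) ⟨
      s′ i + 1# * weight i              ∎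

    s≋s′ : point s ≋ point s′
    s≋s′ d = begin
      point s d                                                          ≈⟨ point-cong {s} {λ i → s′ i + 1# * weight i} s≈s′+weight d ⟩
      point (λ i → s′ i + 1# * weight i) d                               ≈⟨ point-shift s′ weight 1# d ⟩
      point s′ d + 1# * sum (λ i → sign i (weight i) * θ i d)            ≈⟨ +-congˡ (*-congˡ (weight-dependence d)) ⟩
      point s′ d + 1# * 0#                                               ≈⟨ solve 1 (λ a → a :+ con (+ 1) :* con (+ 0) := a) refl _ ⟩
      point s′ d                                                         ∎

    s-in-both : w ∙ point s ≈ β
    s-in-both = proj₂ (face⊆
      ( ⊆P (s , us , set-same weight k 1# , λ _ → refl)
      , ⊆P′ (s′ , us′ , set-other (λ _ → 0#) _ j≢k , s≋s′)))

    i : Fin 4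
    i = proj₁ (third-index j k)

    i≢j : i ≢ j
    i≢j = proj₁ (proj₂ (third-index j k))

    i≢k : i ≢ k
    i≢k = proj₂ (proj₂ (third-index j k))

    -- A point of the facet `s k = 1` outside the other facet: lowering coordinate `j` of `q` from 1
    -- to 0 along the fibre would push coordinate `i` below 0.
    q : Vector Carrier 4
    q = set ones i 0#

    -- The gradient of `w` vanishes away from `k`, where `s` is interior, and `q` agrees with `s` at
    -- `k`; so `q` lies in the supposed common face.
    flat : ∀ l → gradient w l * q l ≈ gradient w l * s l
    flat l with l ≟ k
    ... | yes ≡.refl = *-congˡ (trans (set-other ones 0# (i≢k ∘ ≡.sym)) (sym (set-same weight k 1#)))
    ... | no l≢k = begin
      gradient w l * q l   ≈⟨ *-congʳ g≈0 ⟩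
      0# * q l             ≈⟨ zeroˡ _ ⟩
      0#                   ≈⟨ zeroˡ _ ⟨
      0# * s l             ≈⟨ *-congʳ g≈0 ⟨
      gradient w l * s l   ∎
      where
      sl≈weight : weight l ≈ s l
      sl≈weight = sym (set-other weight 1# l≢k)

      g≈0 : gradient w l ≈ 0#
      g≈0 = interior⇒flat {k} {true} w (λ p∈ → valid (⊆P p∈)) s us (set-same weight k 1#) s-in-both l≢k
        (<-respʳ-≈ sl≈weight (0<weight l)) (<-respˡ-≈ sl≈weight (weight<1 l))

    q∈P : P (point q)
    q∈P = ⊆P (q , unit-set (λ _ → unit-bit true) i (unit-bit false) , set-other ones 0# (i≢k ∘ ≡.sym)
             , λ _ → refl)

    q∈P′ : Facet j false (point q)
    q∈P′ = P′⊆ (proj₂ (⊆face (q∈P , trans (∙-point-cong w q s flat) s-in-both)))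

    q′ : Vector Carrier 4
    q′ = proj₁ q∈P′

    uq′ : Unit q′
    uq′ = proj₁ (proj₂ q∈P′)

    q≋q′ : point q ≋ point q′
    q≋q′ = proj₂ (proj₂ (proj₂ q∈P′))

    q′j<qj : q′ j < q j
    q′j<qj = <-respˡ-≈ (sym (proj₁ (proj₂ (proj₂ q∈P′))))
      (<-respʳ-≈ (sym (set-other ones 0# (i≢j ∘ ≡.sym))) 0<1)

  -- Let `s` represent the vertex inside the facet. An interior coordinate could be moved within the
  -- face, so all coordinates are 0 or 1. None equals `bit b`, since `agrees` would then give this
  -- value at `k` as well. Hence `s` is the opposite constant vector, which represents a different
  -- point.
  constant-vertex : ∀ {P : Region} {k} b → P ≐ Facet k (not b) →
                    ¬ IsFace P (_≋ point (λ _ → bit b))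
  constant-vertex {P} {k} b (P⊆ , ⊆P) (w , β , valid , face⊆ , ⊆face) =
    opposite b (≋-trans v≋s (point-cong {s} {λ _ → bit (not b)} s≈not-b))
    where
    v : Point
    v = point (λ _ → bit b)

    v∈P : Facet k (not b) v
    v∈P = P⊆ (proj₁ (face⊆ (λ _ → refl)))

    s : Vector Carrier 4
    s = proj₁ v∈P

    us : Unit s
    us = proj₁ (proj₂ v∈P)

    sk≈ : s k ≈ bit (not b)
    sk≈ = proj₁ (proj₂ (proj₂ v∈P))

    v≋s : v ≋ point s
    v≋s = proj₂ (proj₂ (proj₂ v∈P))

    ws≈β : w ∙ point s ≈ β
    ws≈β = trans (∙-congˡ-≋ w (≋-sym v≋s)) (proj₂ (face⊆ (λ _ → refl)))

    s≉b : ∀ i → ¬ s i ≈ bit b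
    s≉b i si≈b = bit-not b (trans (agrees (λ _ → bit b) s v≋s (sym si≈b) k) sk≈)

    not-interior : ∀ i → 0# < s i → s i < 1# → ⊥
    not-interior i 0<si si<1 with i ≟ k
    ... | yes ≡.refl = boundary (not b) sk≈
      where
      boundary : ∀ b′ → s i ≈ bit b′ → ⊥
      boundary true  si≈1 = <⇒≉ si<1 si≈1
      boundary false si≈0 = <⇒≉ 0<si (sym si≈0)
    -- The moved vector `t` represents the same point and still agrees with `s` at `k`, so it agrees
    -- everywhere, although `t i` is 0.
    ... | no i≢k = <⇒≉ 0<si (trans (sym (set-same s i 0#))
          (agrees t s t≋s (set-other s 0# (i≢k ∘ ≡.sym)) i))
      where
      t : Vector Carrier 4
      t = set s i 0#

      g≈0 : gradient w i ≈ 0#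
      g≈0 = interior⇒flat {k} {not b} w (λ p∈ → valid (⊆P p∈)) s us sk≈ ws≈β i≢k 0<si si<1

      wt≈β : w ∙ point t ≈ β
      wt≈β = begin
        w ∙ point t                                 ≈⟨ ∙-point-set w s i 0# ⟩
        w ∙ point s + gradient w i * (0# - s i)     ≈⟨ +-cong ws≈β (trans (*-congʳ g≈0) (zeroˡ _)) ⟩
        β + 0#                                      ≈⟨ +-identityʳ β ⟩
        β                                           ∎

      t≋s : point t ≋ point s
      t≋s = ≋-trans
        (⊆face (⊆P (t , unit-set us i (unit-bit false) , trans (set-other s 0# (i≢k ∘ ≡.sym)) sk≈
                   , λ _ → refl) , wt≈β))
        v≋s

    either : ∀ b {a} → 0# ≈ a ⊎ a ≈ 1# → ¬ a ≈ bit b → a ≈ bit (not b)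
    either true  (inj₁ 0≈a) _   = sym 0≈a
    either true  (inj₂ a≈1) a≉b = ⊥-elim (a≉b a≈1)
    either false (inj₁ 0≈a) a≉b = ⊥-elim (a≉b (sym 0≈a))
    either false (inj₂ a≈1) _   = a≈1

    ends : ∀ i → InUnitInterval (s i) → 0# ≈ s i ⊎ s i ≈ 1#
    ends i (inj₂ 0≈si , _)         = inj₁ 0≈si
    ends i (inj₁ _ , inj₂ si≈1)    = inj₂ si≈1
    ends i (inj₁ 0<si , inj₁ si<1) = ⊥-elim (not-interior i 0<si si<1)

    s≈not-b : ∀ i → s i ≈ bit (not b)
    s≈not-b i = either b (ends i (us i)) (s≉b i)

    opposite : ∀ b → ¬ (point (λ _ → bit b) ≋ point (λ _ → bit (not b)))
    opposite true  = all-ones≋all-zeros⇒⊥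
    opposite false = all-ones≋all-zeros⇒⊥ ∘ ≋-sym

  -- The point has coordinate `i` equal to 1, coordinate `j` equal to 0 and coordinate `a` strictly
  -- in between. Along the fibre, raising `a` to 1 pushes `i` above 1, and lowering `a` to 0 pushes
  -- `j` below 0. This is a point that an upper and a lower cube with the same index leave
  -- uncovered.
  crossing : ∀ (a : Fin 4) → ∃[ s ] (Unit s × (∀ b → ¬ Facet a b (point s)))
  crossing a = s , us , λ { b (t , ut , ta≈b , s≋t) → excluded b t ut ta≈b s≋t }
    where
    i j : Fin 4
    i = proj₁ (third-index a a)
    j = proj₁ (third-index a i)

    i≢a : i ≢ a
    i≢a = proj₁ (proj₂ (third-index a a))

    j≢a : j ≢ a
    j≢a = proj₁ (proj₂ (third-index a i))

    j≢i : j ≢ i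
    j≢i = proj₂ (proj₂ (third-index a i))

    e s : Vector Carrier 4
    e = set (λ _ → 0#) i 1#
    s = set e a (weight a)

    us : Unit s
    us = unit-set {e} (unit-set (λ _ → unit-bit false) i (unit-bit true)) a (unit-weight a)

    si≈1 : s i ≈ 1#
    si≈1 = trans (set-other e (weight a) i≢a) (set-same (λ _ → 0#) i 1#)

    sj≈0 : s j ≈ 0#
    sj≈0 = trans (set-other e (weight a) j≢a) (set-other (λ _ → 0#) 1# j≢i)

    excluded : ∀ b t → Unit t → t a ≈ bit b → ¬ (point s ≋ point t)
    excluded true t ut ta≈1 s≋t = <⇒≱ (<-respˡ-≈ si≈1 (rises s t s≋t {a} sa<ta i)) (proj₂ (ut i))
      where
      sa<ta : s a < t a
      sa<ta = <-respˡ-≈ (sym (set-same e a _)) (<-respʳ-≈ (sym ta≈1) (weight<1 a))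
    excluded false t ut ta≈0 s≋t = <⇒≱ (<-respʳ-≈ sj≈0 (rises t s (≋-sym s≋t) {a} ta<sa j)) (proj₁ (ut j))
      where
      ta<sa : t a < s a
      ta<sa = <-respʳ-≈ (sym (set-same e a _)) (<-respˡ-≈ (sym ta≈0) (0<weight a))

-- Cubes as facets, and vertices of the zonotope

-- Describes the three directions of a cube by the one index they omit, so that a single argument
-- over `punchIn m` replaces a case for each triple.
missing-index : ∀ (i j k : Fin 4) → i Fin.< j → j Fin.< k →
                ∃[ m ] (i ≡ punchIn m 0F × j ≡ punchIn m 1F × k ≡ punchIn m 2F)
missing-index = toWitness {a? = all? λ i → all? λ j → all? λ k → i <? j →-dec j <? k →-dec
  any? λ m → i ≟ punchIn m 0F ×-dec j ≟ punchIn m 1F ×-dec k ≟ punchIn m 2F} _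

flipᵇ : Fin 4 → Bool → Bool
flipᵇ 0F b = b
flipᵇ 1F b = not b
flipᵇ 2F b = b
flipᵇ 3F b = not b

module Vertices {c ℓ₁ ℓ₂} {F : OrderedField c ℓ₁ ℓ₂} {Θ : Configuration F 4}
                (K : Balance F Θ) where
  open OrderedField F
  open OrderedFieldProperties F
  open Space F
  open Configuration Θ
  open Cubillages F Θ
  open Coordinates F Θ
  open Balance K
  open Facets K
  open Exclusion K
  open IntegerSolver commutativeRing
  open Sums +-commutativeMonoid using (sum-cong-≋; sum-remove)
  open SetoidReasoning setoid

  flip-involutive : ∀ i a → flip i (flip i a) ≈ a
  flip-involutive 0F a = refl
  flip-involutive 1F a = solve 1 (λ a → con (+ 1) :- (con (+ 1) :- a) := a) refl a
  flip-involutive 2F a = refl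
  flip-involutive 3F a = solve 1 (λ a → con (+ 1) :- (con (+ 1) :- a) := a) refl a

  unit-complement : ∀ {a} → InUnitInterval a → InUnitInterval (1# - a)
  unit-complement {a} (0≤a , a≤1) = a≤b⇒0≤b-a a≤1 ,
    0≤b-a⇒a≤b (≤-respʳ (solve 1 (λ a → a := con (+ 1) :- (con (+ 1) :- a)) refl a) 0≤a)

  unit-flip : ∀ i {a} → InUnitInterval a → InUnitInterval (flip i a)
  unit-flip 0F ua = ua
  unit-flip 1F ua = unit-complement ua
  unit-flip 2F ua = ua
  unit-flip 3F ua = unit-complement ua

  flip-bit : ∀ i b → flip i (bit b) ≈ bit (flipᵇ i b)
  flip-bit 0F b     = refl
  flip-bit 1F true  = -‿inverseʳ 1#
  flip-bit 1F false = solve 0 (con (+ 1) :- con (+ 0) := con (+ 1)) refl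
  flip-bit 2F b     = refl
  flip-bit 3F true  = -‿inverseʳ 1#
  flip-bit 3F false = solve 0 (con (+ 1) :- con (+ 0) := con (+ 1)) refl

  flip-bit′ : ∀ i b → flip i (bit (flipᵇ i b)) ≈ bit b
  flip-bit′ i b = trans (flip-cong i (sym (flip-bit i b))) (flip-involutive i (bit b))

  bit-* : ∀ b a → bit b * a ≈ (if b then a else 0#)
  bit-* true  a = *-identityˡ a
  bit-* false a = zeroˡ a

  subset-point : ∀ X → ⟦ X ⟧ ≋ point (λ i → bit (flipᵇ i (lookup X i)))
  subset-point X d = sum-cong-≋ λ i → sym (trans
    (*-congʳ {x = θ i d} (flip-bit′ i (lookup X i))) (bit-* (lookup X i) (θ i d)))

  zonotope⇒point : ∀ {p} → zonotope p → ∃[ s ] (Unit s × p ≋ point s)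
  zonotope⇒point (t , ut , p≋) = (λ i → flip i (t i)) , (λ i → unit-flip i (ut i)) , λ d →
    trans (p≋ d) (sum-cong-≋ λ i → *-congʳ {x = θ i d} (sym (flip-involutive i (t i))))

  point⇒zonotope : ∀ {p} s → Unit s → p ≋ point s → zonotope p
  point⇒zonotope s us p≋ = (λ i → flip i (s i)) , (λ i → unit-flip i (us i)) , p≋

  -- As `X` avoids the three directions, it can contain only the omitted index `m`. The cube thus
  -- fixes coordinate `m` at the membership bit of `m` in `X` and leaves the others free; `flip`
  -- translates the bit.
  cube-facet : ∀ C → ∃[ m ] ∃[ b ] (ζ C ≐ Facet m b)
  cube-facet C with missing-index (Cube.i C) (Cube.j C) (Cube.k C) (Cube.i<j C) (Cube.j<k C)
  cube-facet record { X = X ; i∉X = i∉X ; j∉X = j∉X ; k∉X = k∉X } | m , ≡.refl , ≡.refl , ≡.refl =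
    m , flipᵇ m χ , ζ⇒facet , facet⇒ζ
    where
    χ : Bool
    χ = lookup X m

    outside-vanishes : ∀ {i} → i ∉ X → ∀ d → (if lookup X i then θ i d else 0#) ≈ 0#
    outside-vanishes {i} i∉X d with lookup X i in eq
    ... | true  = contradiction (lookup⇒[]= i X eq) i∉X
    ... | false = refl

    base : ∀ d → ⟦ X ⟧ d ≈ bit χ * θ m d
    base d = begin
      ⟦ X ⟧ d                             ≈⟨ sum-remove {i = m} (λ i → if lookup X i then θ i d else 0#) ⟩
      (if χ then θ m d else 0#) + (_ + (_ + (_ + 0#)))
        ≈⟨ +-congˡ (+-cong (outside-vanishes i∉X d) (+-cong (outside-vanishes j∉X d)
             (+-congʳ (outside-vanishes k∉X d)))) ⟩
      (if χ then θ m d else 0#) + (0# + (0# + (0# + 0#)))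
        ≈⟨ solve 1 (λ a → let z = con (+ 0) in a :+ (z :+ (z :+ (z :+ z))) := a) refl _ ⟩
      (if χ then θ m d else 0#)           ≈⟨ bit-* χ (θ m d) ⟨
      bit χ * θ m d                       ∎

    combination : ∀ (a : Vector Carrier 4) → a m ≈ bit χ → ∀ d →
      sum (λ i → a i * θ i d) ≈
      ⟦ X ⟧ d + (a (punchIn m 0F) * θ (punchIn m 0F) d
                + (a (punchIn m 1F) * θ (punchIn m 1F) d + a (punchIn m 2F) * θ (punchIn m 2F) d))
    combination a am≈χ d = begin
      sum (λ i → a i * θ i d)             ≈⟨ sum-remove {i = m} (λ i → a i * θ i d) ⟩
      a m * θ m d + (_ + (_ + (_ + 0#)))  ≈⟨ +-cong (trans (*-congʳ am≈χ) (sym (base d)))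
                                              (+-congˡ (+-congˡ (+-identityʳ _))) ⟩
      ⟦ X ⟧ d + (_ + (_ + _))             ∎

    ζ⇒facet : ∀ {p} → _ → Facet m (flipᵇ m χ) p
    ζ⇒facet {p} (r , s , t , ur , us , ut , p≋) =
      (λ i → flip i (a i)) , (λ i → unit-flip i (ua i)) , trans (flip-cong m am≈χ) (flip-bit m χ) , λ d → begin
        p d                                                     ≈⟨ p≋ d ⟩
        ⟦ X ⟧ d + (r * _ + (s * _ + t * _))                     ≈⟨ +-congˡ (+-cong (*-congʳ (sym (a≈ 0F)))
                                                                    (+-cong (*-congʳ (sym (a≈ 1F))) (*-congʳ (sym (a≈ 2F))))) ⟩
        ⟦ X ⟧ d + (a (punchIn m 0F) * _ + (a (punchIn m 1F) * _ + a (punchIn m 2F) * _))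
                                                                ≈⟨ combination a am≈χ d ⟨
        sum (λ i → a i * θ i d)                                 ≈⟨ sum-cong-≋ (λ i → *-congʳ {x = θ i d} (flip-involutive i (a i))) ⟨
        point (λ i → flip i (a i)) d                            ∎
      where
      rst : Vector Carrier 3
      rst = r Vector.∷ s Vector.∷ t Vector.∷ Vector.[]

      a : Vector Carrier 4
      a = Vector.insertAt rst m (bit χ)

      am≈χ : a m ≈ bit χ
      am≈χ = reflexive (insertAt-lookup rst m (bit χ))

      a≈ : ∀ l → a (punchIn m l) ≈ rst l
      a≈ l = reflexive (insertAt-punchIn rst m (bit χ) l)

      ua : Unit a
      ua i with i ≟ m
      ... | yes ≡.refl = unit-resp am≈χ (unit-bit χ)
      ... | no i≢m     = ≡.subst (InUnitInterval ∘ a) (punchIn-punchOut (i≢m ∘ ≡.sym))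
                           (urst (Fin.punchOut (i≢m ∘ ≡.sym)))
        where
        urst : ∀ l → InUnitInterval (a (punchIn m l))
        urst 0F = unit-resp (a≈ 0F) ur
        urst 1F = unit-resp (a≈ 1F) us
        urst 2F = unit-resp (a≈ 2F) ut

    facet⇒ζ : ∀ {p} → Facet m (flipᵇ m χ) p → _
    facet⇒ζ (s , us , sm≈ , p≋) = a (punchIn m 0F) , a (punchIn m 1F) , a (punchIn m 2F)
      , unit-flip (punchIn m 0F) (us (punchIn m 0F))
      , unit-flip (punchIn m 1F) (us (punchIn m 1F))
      , unit-flip (punchIn m 2F) (us (punchIn m 2F))
      , λ d → trans (p≋ d) (combination a (trans (flip-cong m sm≈) (flip-bit′ m χ)) d)
      where
      a : Vector Carrier 4
      a i = flip i (s i)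

  -- The functional separating β is positive on the coordinates where β is true
  -- and negative where it is false, so on the unit cube it peaks at β alone.
  mixed-vertex-face : ∀ (β : Fin 4 → Bool) {i j} → β i ≡ true → β j ≡ false →
                      IsFace zonotope (_≋ point (bit ∘ β))
  mixed-vertex-face β {i} {j} βi≡true βj≡false =
    w , w ∙ point v , valid , (λ p≋v → point⇒zonotope v (unit-bit ∘ β) p≋v , ∙-congˡ-≋ w p≋v) , peak
    where
    v : Vector Carrier 4
    v = bit ∘ β

    μ : Carrier
    μ = sum (λ l → v l * weight l)

    w : Point
    w = proj₁ (separator v)

    w≈ : ∀ l → gradient w l ≈ v l - μ
    w≈ = proj₂ (separator v)

    bit-weight : ∀ b l → 0# ≤ bit b * weight l
    bit-weight true  l = inj₁ (*-positive 0<1 (0<weight l))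
    bit-weight false l = inj₂ (sym (zeroˡ _))

    co-bit-weight : ∀ b l → 0# ≤ (1# - bit b) * weight l
    co-bit-weight true  l = inj₂ (sym (trans (*-congʳ (-‿inverseʳ 1#)) (zeroˡ _)))
    co-bit-weight false l = inj₁ (*-positive (a<b⇒0<b-a 0<1) (0<weight l))

    -- The weighted mean `μ` of the bits lies strictly between 0 and 1 because `β` takes both
    -- values: index `i` gives the lower bound, index `j` the upper one.
    0<μ : 0# < μ
    0<μ = sum-positive (λ l → v l * weight l) (λ l → bit-weight (β l) l) i
      (<-respʳ-≈ (sym (trans (*-congʳ (reflexive (≡.cong bit βi≡true))) (*-identityˡ _))) (0<weight i))

    0<1-μ : 0# < 1# - μ
    0<1-μ = <-respʳ-≈ total
      (sum-positive (λ l → (1# - v l) * weight l) (λ l → co-bit-weight (β l) l) j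
        (<-respʳ-≈ (*-congʳ (+-congˡ (-‿cong (reflexive (≡.cong bit (≡.sym βj≡false))))))
          (*-positive (a<b⇒0<b-a 0<1) (0<weight j))))
      where
      total : sum (λ l → (1# - v l) * weight l) ≈ 1# - μ
      total = trans (complement-sum v weight) (+-congʳ sum-weight)
        where
        complement-sum : ∀ (v u : Vector Carrier 4) →
                         sum (λ l → (1# - v l) * u l) ≈ sum u - sum (λ l → v l * u l)
        complement-sum v u = solve 8 (λ a b c d p q r t → let o = con (+ 1) ; z = con (+ 0) in
            (o :- a) :* p :+ ((o :- b) :* q :+ ((o :- c) :* r :+ ((o :- d) :* t :+ z)))
            := (p :+ (q :+ (r :+ (t :+ z)))) :- (a :* p :+ (b :* q :+ (c :* r :+ (d :* t :+ z)))))
          refl (v 0F) (v 1F) (v 2F) (v 3F) (u 0F) (u 1F) (u 2F) (u 3F)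

    term-nonNegative : ∀ b {a} → InUnitInterval a → 0# ≤ (bit b - μ) * (bit b - a)
    term-nonNegative true  (_ , a≤1) = *-nonNegative 0<1-μ (a≤b⇒0≤b-a a≤1)
    term-nonNegative false {a} (0≤a , _) = ≤-respʳ
      (solve 2 (λ m a → m :* a := (con (+ 0) :- m) :* (con (+ 0) :- a)) refl μ a)
      (*-nonNegative 0<μ 0≤a)

    term-zero : ∀ b {a} → 0# ≈ (bit b - μ) * (bit b - a) → a ≈ bit b
    term-zero true {a} 0≈ = begin
      a               ≈⟨ +-identityʳ a ⟨
      a + 0#          ≈⟨ +-congˡ (*-cancel-zero 0<1-μ 0≈) ⟩
      a + (1# - a)    ≈⟨ solve 1 (λ a → a :+ (con (+ 1) :- a) := con (+ 1)) refl a ⟩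
      1#              ∎
    term-zero false {a} 0≈ = sym (*-cancel-zero 0<μ (trans 0≈
      (solve 2 (λ m a → (con (+ 0) :- m) :* (con (+ 0) :- a) := m :* a) refl μ a)))

    -- The loss of `w` in passing from `v` to `s` splits into these terms. On the unit cube each is
    -- nonnegative, and zero only where `s` agrees with `v`.
    deficit : Vector Carrier 4 → Vector Carrier 4
    deficit s l = (v l - μ) * (v l - s l)

    drop : ∀ s → w ∙ point v - w ∙ point s ≈ sum (deficit s)
    drop s = begin
      w ∙ point v - w ∙ point s      ≈⟨ +-cong (∙-point w v) (-‿cong (∙-point w s)) ⟩
      (offset w + sum (λ l → gradient w l * v l)) - (offset w + sum (λ l → gradient w l * s l))
                                     ≈⟨ difference (offset w) (gradient w) v s ⟩
      sum (λ l → gradient w l * (v l - s l))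
                                     ≈⟨ sum-cong-≋ (λ l → *-congʳ {x = v l - s l} (w≈ l)) ⟩
      sum (deficit s)                ∎
      where
      difference : ∀ o (g v s : Vector Carrier 4) →
        (o + sum (λ l → g l * v l)) - (o + sum (λ l → g l * s l)) ≈ sum (λ l → g l * (v l - s l))
      difference o g v s = solve 13 (λ o g₀ g₁ g₂ g₃ a b c d p q r t → let z = con (+ 0) in
          (o :+ (g₀ :* a :+ (g₁ :* b :+ (g₂ :* c :+ (g₃ :* d :+ z)))))
            :- (o :+ (g₀ :* p :+ (g₁ :* q :+ (g₂ :* r :+ (g₃ :* t :+ z)))))
          := g₀ :* (a :- p) :+ (g₁ :* (b :- q) :+ (g₂ :* (c :- r) :+ (g₃ :* (d :- t) :+ z))))
        refl o (g 0F) (g 1F) (g 2F) (g 3F) (v 0F) (v 1F) (v 2F) (v 3F) (s 0F) (s 1F) (s 2F) (s 3F)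

    deficit-nonNegative : ∀ s → Unit s → ∀ l → 0# ≤ deficit s l
    deficit-nonNegative s us l = term-nonNegative (β l) (us l)

    valid : ∀ {p} → zonotope p → w ∙ p ≤ w ∙ point v
    valid p∈ with zonotope⇒point p∈
    ... | s , us , p≋s = ≤-respˡ (sym (∙-congˡ-≋ w p≋s)) (0≤b-a⇒a≤b
      (≤-respʳ (sym (drop s)) (sum-nonNegative (deficit s) (deficit-nonNegative s us))))

    peak : ∀ {p} → zonotope p × w ∙ p ≈ w ∙ point v → p ≋ point v
    peak (p∈ , wp≈) with zonotope⇒point p∈
    ... | s , us , p≋s = ≋-trans p≋s (point-cong {s} {v} λ l → term-zero (β l)
      (sum-zero (deficit s) (deficit-nonNegative s us) (trans (sym no-drop) (drop s)) l))
      where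
      no-drop : w ∙ point v - w ∙ point s ≈ 0#
      no-drop = trans (+-congʳ (trans (sym wp≈) (∙-congˡ-≋ w p≋s))) (-‿inverseʳ _)

-- Vertices of a cubillage

[24] : Subset 4
[24] = outside Vec.∷ inside Vec.∷ outside Vec.∷ inside Vec.∷ Vec.[]

module CubillageVertices {c ℓ₁ ℓ₂} {F : OrderedField c ℓ₁ ℓ₂} {Θ : Configuration F 4}
                         (K : Balance F Θ)
                         (Q : List (Cube 4)) (Q-cubillage : Cubillages.IsCubillage F Θ Q) where
  open OrderedField F
  open Space F
  open Cubillages F Θ
  open Coordinates F Θ
  open Facets K
  open Exclusion K
  open Vertices K
  open IsCubillage Q-cubillage

  -- Such a set is a vertex of the zonotope, and `boundary-faces` supplies a cube of `Q` having it
  -- as a face.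
  mixed-vertex : ∀ X {i j} → flipᵇ i (lookup X i) ≡ true → flipᵇ j (lookup X j) ≡ false → V Q X
  mixed-vertex X {i} {j} i-true j-false = unlift (boundary-faces G face proper)
    where
    v : Fin 4 → Carrier
    v i = bit (flipᵇ i (lookup X i))

    -- The lift only adjusts the universe level to the one over which `boundary-faces` quantifies.
    G : Region
    G p = Lift (c ⊔ ℓ₂) (p ≋ point v)

    lift-face : IsFace zonotope (_≋ point v) → IsFace zonotope G
    lift-face (w , b , valid , ⊆face , face⊆) =
      w , b , valid , (λ p≋v → ⊆face (lower p≋v)) , (λ p∈ → lift (face⊆ p∈))

    face : IsFace zonotope G
    face = lift-face (mixed-vertex-face (λ i → flipᵇ i (lookup X i)) {i} {j} i-true j-false)

    -- The face is proper since the zonotope contains the distinct points 13 and 24.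
    proper : ¬ (∀ {p} → zonotope p → G p)
    proper all≋v = all-ones≋all-zeros⇒⊥ (≋-trans
      (lower (all≋v (point⇒zonotope (λ _ → 1#) (λ _ → unit-bit true) (λ _ → refl))))
      (≋-sym (lower (all≋v (point⇒zonotope (λ _ → 0#) (λ _ → unit-bit false) (λ _ → refl))))))

    unlift : ∃[ C ] (C List.∈ Q × IsFace (ζ C) G) → V Q X
    unlift (C , C∈Q , w , b , valid , ⊆face , face⊆) = C , C∈Q , w , b , valid
      , (λ p≋X → ⊆face (lift (≋-trans p≋X (subset-point X))))
      , (λ p∈ → ≋-trans (lower (face⊆ p∈)) (≋-sym (subset-point X)))

  HasFacet : Fin 4 → Bool → Set _
  HasFacet m b = ∃[ C ] (C List.∈ Q × ζ C ≐ Facet m b)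

  -- The cube having this vertex is upper or lower, and `constant-vertex` excludes the wrong kind.
  constant-vertex⇒facet : ∀ X b → ⟦ X ⟧ ≋ point (λ _ → bit b) → V Q X → ∃[ m ] HasFacet m b
  constant-vertex⇒facet X b X≋ (C , C∈Q , w , β , valid , ⊆face , face⊆) =
    case-facet (cube-facet C)
    where
    face : IsFace (ζ C) (_≋ point (λ _ → bit b))
    face = w , β , valid , (λ p≋ → ⊆face (≋-trans p≋ (≋-sym X≋))) , (λ p∈ → ≋-trans (face⊆ p∈) X≋)

    bool-dichotomy : ∀ b b′ → b′ ≡ b ⊎ b′ ≡ not b
    bool-dichotomy true  true  = inj₁ ≡.refl
    bool-dichotomy true  false = inj₂ ≡.refl
    bool-dichotomy false true  = inj₂ ≡.refl
    bool-dichotomy false false = inj₁ ≡.refl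

    case-facet : ∃[ m ] ∃[ b′ ] (ζ C ≐ Facet m b′) → ∃[ m ] HasFacet m b
    case-facet (m , b′ , C≐) with bool-dichotomy b b′
    ... | inj₁ ≡.refl = m , C , C∈Q , C≐
    ... | inj₂ ≡.refl = contradiction face (constant-vertex {ζ C} {m} b C≐)

  upper-lower⇒≡ : ∀ {k j} → HasFacet k true → HasFacet j false → ¬ (j ≢ k)
  upper-lower⇒≡ (C , C∈Q , C≐) (D , D∈Q , D≐) j≢k =
    upper-lower-overlap C≐ D≐ j≢k (proj₁ (common-faces C∈Q D∈Q))

  -- For equal indices the point from `crossing` must lie in a third cube, whose index differs from
  -- `k`. If that cube is upper it clashes with the lower cube, and if lower with the upper one.
  upper-lower⇒⊥ : ∀ {k j} → HasFacet k true → ¬ HasFacet j false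
  upper-lower⇒⊥ {k} {j} upper lower with j ≟ k
  ... | no j≢k     = upper-lower⇒≡ upper lower j≢k
  ... | yes ≡.refl = third-facet (proj₁ covers (point⇒zonotope s us (λ _ → refl)))
    where
    s : Fin 4 → Carrier
    s = proj₁ (crossing k)

    us : Unit s
    us = proj₁ (proj₂ (crossing k))

    third-facet : ¬ (∃[ E ] (E List.∈ Q × ζ E (point s)))
    third-facet (E , E∈Q , s∈E) = locate (cube-facet E)
      where
      locate : ¬ (∃[ m ] ∃[ b ] (ζ E ≐ Facet m b))
      locate (m , b , E≐) with m ≟ k
      locate (m , b     , E≐) | yes ≡.refl = proj₂ (proj₂ (crossing k)) b (proj₁ E≐ s∈E)
      locate (m , true  , E≐) | no m≢k     = upper-lower⇒≡ (E , E∈Q , E≐) lower (m≢k ∘ ≡.sym)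
      locate (m , false , E≐) | no m≢k     = upper-lower⇒≡ upper (E , E∈Q , E≐) m≢k

  [13]≋ : ⟦ [13] ⟧ ≋ point (λ _ → bit true)
  [13]≋ = ≋-trans (subset-point [13])
    (point-cong {λ i → bit (flipᵇ i (lookup [13] i))} {λ _ → bit true}
      λ { 0F → refl ; 1F → refl ; 2F → refl ; 3F → refl })

  [24]≋ : ⟦ [24] ⟧ ≋ point (λ _ → bit false)
  [24]≋ = ≋-trans (subset-point [24])
    (point-cong {λ i → bit (flipᵇ i (lookup [24] i))} {λ _ → bit false}
      λ { 0F → refl ; 1F → refl ; 2F → refl ; 3F → refl })

  [13]-vertex⇒[24]-not-vertex : V Q [13] → ¬ V Q [24]
  [13]-vertex⇒[24]-not-vertex v₁₃ v₂₄ = upper-lower⇒⊥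
    (proj₂ (constant-vertex⇒facet [13] true [13]≋ v₁₃))
    (proj₂ (constant-vertex⇒facet [24] false [24]≋ v₂₄))

-- Decidable maximality and the two collections

_≟ₛ_ : ∀ {n} → DecidableEquality (Subset n)
_≟ₛ_ = ≡-dec Bool._≟_

subsets : ∀ n → List (Subset n)
subsets ℕ.zero    = Vec.[] ∷ []
subsets (ℕ.suc n) = List.map (inside Vec.∷_) (subsets n) ++ List.map (outside Vec.∷_) (subsets n)

∈-subsets : ∀ {n} (X : Subset n) → X List.∈ subsets n
∈-subsets Vec.[]             = here ≡.refl
∈-subsets (true  Vec.∷ X)    = ∈-++⁺ˡ (∈-map⁺ (inside Vec.∷_) (∈-subsets X))
∈-subsets (false Vec.∷ X)    = ∈-++⁺ʳ _ (∈-map⁺ (outside Vec.∷_) (∈-subsets X))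

allSubsets? : ∀ {n p} {P : Pred (Subset n) p} → Decidable P → Dec (∀ X → P X)
allSubsets? P? = map′ (λ all X → All.lookup all (∈-subsets X)) (λ all → All.universal all _)
                      (All.all? P? (subsets _))

stronglySeparated? : ∀ {n} → Decidable₂ (StronglySeparated {n})
stronglySeparated? A B = (A ≟ₛ B) ⊎-dec ((_ ℕ.<? _) ⊎-dec (_ ℕ.<? _))

surrounds? : ∀ {n} → Decidable₂ (_Surrounds_ {n})
surrounds? A B = ¬? (any? λ i → any? λ j → any? λ k →
  i <? j ×-dec j <? k ×-dec i ∈? (B ─ A) ×-dec k ∈? (B ─ A) ×-dec j ∈? (A ─ B))

weaklySeparated? : ∀ {n} → Decidable₂ (WeaklySeparated {n})
weaklySeparated? A B = ((∣ A ∣ ℕ.≤? ∣ B ∣) ×-dec surrounds? A B)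
                 ⊎-dec ((∣ B ∣ ℕ.≤? ∣ A ∣) ×-dec surrounds? B A)

module _ {Separated : Rel (Subset 4) Level.zero} where

  -- Maximality among all subsets but `Y`, stated by quantifying over single sets instead of
  -- collections, so that it can be decided by enumeration: each set is `Y`, a member, or in
  -- conflict with a member.
  MaximalAvoiding : Subset 4 → List (Subset 4) → Set
  MaximalAvoiding Y C =
    Unique C × All (λ A → A ≢ Y × All (Separated A) C) C
             × (∀ X → X ≡ Y ⊎ X List.∈ C ⊎ Any (λ A → ¬ Separated A X) C)

  maximalAvoiding? : Decidable₂ Separated → Decidable₂ MaximalAvoiding
  maximalAvoiding? separated? Y C =
    DecUnique.unique? _≟ₛ_ C
    ×-dec All.all? (λ A → ¬? (A ≟ₛ Y) ×-dec All.all? (separated? A) C) C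
    ×-dec allSubsets? (λ X → X ≟ₛ Y ⊎-dec DecMembership._∈?_ _≟ₛ_ X C
                             ⊎-dec Any.any? (λ A → ¬? (separated? A X)) C)

  module _ {ℓ} {𝒟 : Pred (Subset 4) ℓ} {Y : Subset 4}
           (others : ∀ X → X ≢ Y → 𝒟 X) (Y∉𝒟 : ¬ 𝒟 Y) where
    open Purity Separated 𝒟

    maximalAvoiding⇒maximal : ∀ {C} → MaximalAvoiding Y C → IsMaximalCollection C
    maximalAvoiding⇒maximal {C} (unique , separated , maximal) =
      ( unique
      , (λ A∈C → others _ (proj₁ (All.lookup separated A∈C)))
      , (λ A∈C B∈C → All.lookup (proj₂ (All.lookup separated A∈C)) B∈C) )
      , λ C′ (_ , C′⊆𝒟 , C′-separated) C⊆C′ {X} X∈C′ → case maximal X of λ where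
          (inj₁ ≡.refl)       → contradiction (C′⊆𝒟 X∈C′) Y∉𝒟
          (inj₂ (inj₁ X∈C))   → X∈C
          (inj₂ (inj₂ clash)) → let A , A∈C , ¬sep = find clash in
                                contradiction (C′-separated (C⊆C′ A∈C) X∈C′) ¬sep

    impure : ∀ {C C′} → MaximalAvoiding Y C → MaximalAvoiding Y C′ → length C ≢ length C′ → ¬ Pure
    impure max max′ ≢ pure = ≢ (pure _ _ (maximalAvoiding⇒maximal max) (maximalAvoiding⇒maximal max′))

without : List (Subset 4) → List (Subset 4)
without Xs = filter (λ X → ¬? (DecMembership._∈?_ _≟ₛ_ X Xs)) (subsets 4)

[3] [14] [23] [124] [134] : Subset 4
[3]   = ⁅ 2F ⁆
[14]  = ⁅ 0F ⁆ ∪ ⁅ 3F ⁆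
[23]  = ⁅ 1F ⁆ ∪ ⁅ 2F ⁆
[124] = ⁅ 0F ⁆ ∪ ⁅ 1F ⁆ ∪ ⁅ 3F ⁆
[134] = ⁅ 0F ⁆ ∪ ⁅ 2F ⁆ ∪ ⁅ 3F ⁆

-- The larger collection consists of all intervals of [4], the empty one included. For the smaller
-- one, `[24]` is separated from each of its ten members; only the absence of `[24]` from the vertex
-- set leaves it maximal.
collection₁₀ collection₁₁ : List (Subset 4)
collection₁₀ = without ([24] ∷ [3] ∷ [13] ∷ [14] ∷ [23] ∷ [134] ∷ [])
collection₁₁ = without ([24] ∷ [13] ∷ [14] ∷ [124] ∷ [134] ∷ [])

module _ {ℓ} {𝒟 : Pred (Subset 4) ℓ} (others : ∀ X → X ≢ [24] → 𝒟 X) ([24]∉𝒟 : ¬ 𝒟 [24]) where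

  ¬SPure : ¬ SPure 𝒟
  ¬SPure = impure others [24]∉𝒟
    (toWitness {a? = maximalAvoiding? stronglySeparated? [24] collection₁₀} _)
    (toWitness {a? = maximalAvoiding? stronglySeparated? [24] collection₁₁} _)
    λ ()

  ¬WPure : ¬ WPure 𝒟
  ¬WPure = impure others [24]∉𝒟
    (toWitness {a? = maximalAvoiding? weaklySeparated? [24] collection₁₀} _)
    (toWitness {a? = maximalAvoiding? weaklySeparated? [24] collection₁₁} _)
    λ ()

-- Determination of the vertex set and conclusion

-- In the flipped coordinates 13 and 24 are the two constant vectors; any other set takes both
-- values, as `mixed-vertex` requires.
classify : ∀ X → X ≡ [13] ⊎ X ≡ [24] ⊎
                 (∃[ i ] ∃[ j ] (flipᵇ i (lookup X i) ≡ true × flipᵇ j (lookup X j) ≡ false))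
classify = toWitness {a? = allSubsets? λ X → X ≟ₛ [13] ⊎-dec X ≟ₛ [24] ⊎-dec
  any? λ i → any? λ j → flipᵇ i (lookup X i) Bool.≟ true ×-dec flipᵇ j (lookup X j) Bool.≟ false} _

lemma3p1 : ∀ {c ℓ₁ ℓ₂ : Level} (F : OrderedField c ℓ₁ ℓ₂) (Θ : Configuration F 4) →
    let open Cubillages F Θ in
    (Q : List (Cube 4)) → IsCubillage Q → V Q [13] →
    ¬ SPure (V Q) × ¬ WPure (V Q)
lemma3p1 F Θ Q Q-cubillage v₁₃ = ¬SPure others ¬v₂₄ , ¬WPure others ¬v₂₄
  where
  open Cubillages F Θ using (V)
  open CubillageVertices (balance F Θ) Q Q-cubillage

  ¬v₂₄ : ¬ V Q [24]
  ¬v₂₄ = [13]-vertex⇒[24]-not-vertex v₁₃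

  others : ∀ X → X ≢ [24] → V Q X
  others X X≢[24] = case classify X of λ where
    (inj₁ ≡.refl)                            → v₁₃
    (inj₂ (inj₁ X≡[24]))                     → contradiction X≡[24] X≢[24]
    (inj₂ (inj₂ (i , j , i-true , j-false))) → mixed-vertex X {i} {j} i-true j-false
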